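{- Let $n\ge 1$ be an integer and let $\mathcal{L}_n(x)$ be a generalized Fibonacci polynomial of Lucas type determined by $d(x)$ and $g(x)$. For $j=0,1,\dots,n-1$ let $\tau_j=2i\cos\frac{(2j+1)\pi}{2n}$, where $i=\sqrt{ -1}$. If $t\in\mathbb{C}$ satisfies $g(t)\ne0$ and $d(t)/\sqrt{g(t)}=\tau_j$ for some $j\in\{0,1,\dots,n-1\}$, then $t$ is a root of $\mathcal{L}_n(x)$.
   Context: Given nonzero polynomials $d(x),g(x)\in\mathbb{Q}[x]$ with $\deg d>\deg g$, the generalized Fibonacci polynomials of Lucas type are $\mathcal{L}_0(x)=p_0$, $\mathcal{L}_1(x)=p_1(x)$, $\mathcal{L}_n(x)=d(x)\mathcal{L}_{n-1}(x)+g(x)\mathcal{L}_{n-2}(x)$ for $n\ge2$, where $p_0\in\{\pm1,\pm2\}$, $\alpha=2/p_0$, and $p_1(x)\in\mathbb{Q}[x]$ satisfies $d(x)=\alpha p_1(x)$. $\sqrt{g(t)}$ denotes a complex square root of $g(t)$. -}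

module Defs where

open import Data.Nat as ℕ using (ℕ; zero; suc; z≤n; s≤s; _!)
import Data.Nat.Properties as ℕ
open import Data.Nat.Properties using (_!≢0)
open import Data.Integer as ℤ using (ℤ; +_; -[1+_]; +≤+; -≤+)
import Data.Integer.Properties as ℤ
open import Data.Integer.Tactic.RingSolver using () renaming (solve-∀ to ℤ-solve-∀)
open import Data.Rational
import Data.Rational.Unnormalised as ℚᵘ
import Data.Rational.Unnormalised.Properties as ℚᵘ
open import Data.Rational.Properties
open import Data.Rational.Solver using (module +-*-Solver)
open import Data.Fin using (Fin; toℕ)
open import Data.List using (List; []; _∷_; map)
open import Data.Product using (_×_; _,_; proj₁; proj₂; ∃; ∃-syntax; ∃₂)
open import Data.Sum using (_⊎_; inj₁; inj₂)
open import Relation.Nullary using (¬_; yes; no; contradiction)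
open import Relation.Binary.PropositionalEquality
  using (_≡_; _≢_; refl; sym; trans; cong; cong₂; subst; subst₂)
open +-*-Solver using (solve; _:+_; _:*_; _:-_; :-_; _:=_; con)

dist-triangle : ∀ a b c → ∣ a - c ∣ ≤ ∣ a - b ∣ + ∣ b - c ∣
dist-triangle a b c = subst (_≤ ∣ a - b ∣ + ∣ b - c ∣)
  (cong ∣_∣ (solve 3 (λ a b c → (a :- b) :+ (b :- c) := a :- c) refl a b c))
  (∣p+q∣≤∣p∣+∣q∣ (a - b) (b - c))

dist-sym : ∀ a b → ∣ a - b ∣ ≡ ∣ b - a ∣
dist-sym a b = trans
  (cong ∣_∣ (solve 2 (λ a b → a :- b := :- (b :- a)) refl a b))
  (∣-p∣≡∣p∣ (b - a))

dist-refl : ∀ a {ε} → 0ℚ < ε → ∣ a - a ∣ < ε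
dist-refl a {ε} 0<ε = subst (_< ε) (sym (cong ∣_∣ (+-inverseʳ a))) 0<ε

0<½* : ∀ {ε} → 0ℚ < ε → 0ℚ < ½ * ε
0<½* {ε} 0<ε = subst (_< ½ * ε) (*-zeroʳ ½) (*-monoʳ-<-pos ½ 0<ε)

½+½ : ∀ ε → ½ * ε + ½ * ε ≡ ε
½+½ ε = trans (sym (*-distribʳ-+ ε ½ ½)) (*-identityˡ ε)

0<*⁺ : ∀ {a b} → 0ℚ < a → 0ℚ < b → 0ℚ < a * b
0<*⁺ {a} {b} 0<a 0<b = subst (_< a * b) (*-zeroʳ a)
  (*-monoʳ-<-pos a {{positive 0<a}} 0<b)

divide-by : ∀ b ε → 0ℚ < b → 0ℚ < ε → ∃[ δ ] 0ℚ < δ × b * δ ≡ ε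
divide-by b ε 0<b 0<ε =
  1/b * ε , 0<*⁺ (positive⁻¹ 1/b {{1/pos⇒pos b}}) 0<ε ,
  trans (sym (*-assoc b 1/b ε)) (trans (cong (_* ε) (*-inverseʳ b)) (*-identityˡ ε))
  where
  instance _ = positive 0<b
           _ = pos⇒nonZero b
  1/b = 1/ b

*-mono-≤-nonNeg : ∀ {a b c d} → 0ℚ ≤ a → 0ℚ ≤ d → a ≤ b → c ≤ d → a * c ≤ b * d
*-mono-≤-nonNeg {a} {b} {c} {d} 0≤a 0≤d a≤b c≤d = ≤-trans
  (*-monoˡ-≤-nonNeg a {{nonNegative 0≤a}} c≤d)
  (*-monoʳ-≤-nonNeg d {{nonNegative 0≤d}} a≤b)

*-0≤ : ∀ {a b} → 0ℚ ≤ a → 0ℚ ≤ b → 0ℚ ≤ a * b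
*-0≤ {a} {b} 0≤a 0≤b = subst (_≤ a * b) (*-zeroʳ a)
  (*-monoˡ-≤-nonNeg a {{nonNegative 0≤a}} 0≤b)

square-0≤ : ∀ a → 0ℚ ≤ a * a
square-0≤ a with ≤-total 0ℚ a
... | inj₁ 0≤a = *-0≤ 0≤a 0≤a
... | inj₂ a≤0 = subst (0ℚ ≤_)
  (solve 1 (λ a → (:- a) :* (:- a) := a :* a) refl a)
  (*-0≤ (neg-antimono-≤ a≤0) (neg-antimono-≤ a≤0))

+-0≤ : ∀ {a b} → 0ℚ ≤ a → 0ℚ ≤ b → 0ℚ ≤ a + b
+-0≤ {a} {b} 0≤a 0≤b = +-mono-≤ 0≤a 0≤b

dist-three-steps : ∀ ε a b c d → ∣ a - b ∣ ≤ ½ * (½ * ε) →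
  ∣ b - c ∣ < ½ * ε → ∣ c - d ∣ ≤ ½ * (½ * ε) → ∣ a - d ∣ < ε
dist-three-steps ε a b c d ab bc cd = ≤-<-trans
  (≤-trans (dist-triangle a b d) (+-monoʳ-≤ ∣ a - b ∣ (dist-triangle b c d)))
  (subst (∣ a - b ∣ + (∣ b - c ∣ + ∣ c - d ∣) <_)
    (trans
      (solve 2 (λ p q → p :+ (q :+ p) := (p :+ p) :+ q) refl (½ * (½ * ε)) (½ * ε))
      (trans (cong (_+ ½ * ε) (½+½ (½ * ε))) (½+½ ε)))
    (+-mono-≤-< ab (+-mono-<-≤ bc cd)))

sum-dist : ∀ ε a b a′ b′ → ∣ a - a′ ∣ < ½ * ε → ∣ b - b′ ∣ < ½ * ε →
  ∣ (a + b) - (a′ + b′) ∣ < ε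
sum-dist ε a b a′ b′ ha hb = ≤-<-trans
  (subst (_≤ ∣ a - a′ ∣ + ∣ b - b′ ∣)
    (cong ∣_∣ (solve 4 (λ a b a′ b′ →
      (a :- a′) :+ (b :- b′) := (a :+ b) :- (a′ :+ b′)) refl a b a′ b′))
    (∣p+q∣≤∣p∣+∣q∣ (a - a′) (b - b′)))
  (subst (∣ a - a′ ∣ + ∣ b - b′ ∣ <_) (½+½ ε) (+-mono-< ha hb))

p≤p+q : ∀ p {q} → 0ℚ ≤ q → p ≤ p + q
p≤p+q p {q} 0≤q = subst (_≤ p + q) (+-identityʳ p) (+-monoʳ-≤ p 0≤q)

product-dist : ∀ {A B δ} a b a′ b′ → 0ℚ < A → 0ℚ < B →
  ∣ a ∣ ≤ A → ∣ b′ ∣ ≤ B → ∣ a - a′ ∣ < δ → ∣ b - b′ ∣ < δ →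
  ∣ a * b - a′ * b′ ∣ < (A + B) * δ
product-dist {A} {B} {δ} a b a′ b′ 0<A 0<B a≤A b′≤B da db =
  ≤-<-trans (subst (_≤ ∣ a ∣ * ∣ b - b′ ∣ + ∣ a - a′ ∣ * ∣ b′ ∣) eq
    (subst (∣ a * (b - b′) + (a - a′) * b′ ∣ ≤_)
      (cong₂ _+_ (∣p*q∣≡∣p∣*∣q∣ a (b - b′)) (∣p*q∣≡∣p∣*∣q∣ (a - a′) b′))
      (∣p+q∣≤∣p∣+∣q∣ (a * (b - b′)) ((a - a′) * b′))))
    (subst (∣ a ∣ * ∣ b - b′ ∣ + ∣ a - a′ ∣ * ∣ b′ ∣ <_)
      (solve 3 (λ A B δ → A :* δ :+ δ :* B := (A :+ B) :* δ) refl A B δ)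
      (+-mono-<
        (≤-<-trans
          (*-monoʳ-≤-nonNeg ∣ b - b′ ∣ {{∣-∣-nonNeg (b - b′)}} a≤A)
          (*-monoʳ-<-pos A {{positive 0<A}} db))
        (≤-<-trans
          (*-monoˡ-≤-nonNeg ∣ a - a′ ∣ {{∣-∣-nonNeg (a - a′)}} b′≤B)
          (*-monoˡ-<-pos B {{positive 0<B}} da))))
  where
  eq : ∣ a * (b - b′) + (a - a′) * b′ ∣ ≡ ∣ a * b - a′ * b′ ∣
  eq = cong ∣_∣ (solve 4 (λ a b a′ b′ →
    a :* (b :- b′) :+ (a :- a′) :* b′ := a :* b :- a′ :* b′) refl a b a′ b′)

-- Real numbers are Cauchy sequences of rationals with the setoid equality _≈ℝ_
-- (the difference tends to 0). The Cauchy proofs are abstract, so that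
-- unfolding a real only unfolds its approximations.

IsCauchy : (ℕ → ℚ) → Set
IsCauchy x = ∀ ε → 0ℚ < ε →
  ∃[ N ] ∀ m n → N ℕ.≤ m → N ℕ.≤ n → ∣ x m - x n ∣ < ε

record ℝ : Set where
  constructor mkℝ
  field
    seq    : ℕ → ℚ
    cauchy : IsCauchy seq

open ℝ public

infix 4 _≈ℝ_ _<ℝ_

record _≈ℝ_ (x y : ℝ) : Set where
  constructor mk≈
  field
    close : ∀ ε → 0ℚ < ε → ∃[ N ] ∀ n → N ℕ.≤ n → ∣ seq x n - seq y n ∣ < ε

record _<ℝ_ (x y : ℝ) : Set where
  constructor mk<
  field
    gap      : ℚ
    gap>0    : 0ℚ < gap
    eventual : ∃[ N ] ∀ n → N ℕ.≤ n → seq x n + gap ≤ seq y n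

abstract
  const-cauchy : ∀ q → IsCauchy (λ _ → q)
  const-cauchy q ε 0<ε =
    0 , λ _ _ _ _ → dist-refl q 0<ε

fromℚ : ℚ → ℝ
fromℚ q = mkℝ (λ _ → q) (const-cauchy q)

0ℝ 1ℝ : ℝ
0ℝ = fromℚ 0ℚ
1ℝ = fromℚ 1ℚ

infixl 6 _+ℝ_
infixl 7 _*ℝ_
infixr 8 _^ℝ_
infix  8 -ℝ_

abstract
  +-cauchy : ∀ x y → IsCauchy (λ n → seq x n + seq y n)
  +-cauchy x y ε 0<ε =
    let (M , hM) = cauchy x (½ * ε) (0<½* 0<ε)
        (N , hN) = cauchy y (½ * ε) (0<½* 0<ε)
    in M ℕ.⊔ N , λ m n m≥ n≥ →
      sum-dist ε (seq x m) (seq y m) (seq x n) (seq y n)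
        (hM m n (ℕ.m⊔n≤o⇒m≤o M N m≥) (ℕ.m⊔n≤o⇒m≤o M N n≥))
        (hN m n (ℕ.m⊔n≤o⇒n≤o M N m≥) (ℕ.m⊔n≤o⇒n≤o M N n≥))

_+ℝ_ : ℝ → ℝ → ℝ
x +ℝ y = mkℝ (λ n → seq x n + seq y n) (+-cauchy x y)

abstract
  neg-cauchy : ∀ x → IsCauchy (λ n → - seq x n)
  neg-cauchy x ε 0<ε =
    let (N , hN) = cauchy x ε 0<ε in N , λ m n m≥ n≥ →
      subst (_< ε)
        (trans (sym (∣-p∣≡∣p∣ (seq x m - seq x n)))
          (cong ∣_∣ (solve 2 (λ a b → :- (a :- b) := (:- a) :- (:- b)) refl
            (seq x m) (seq x n))))
        (hN m n m≥ n≥)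

-ℝ_ : ℝ → ℝ
-ℝ x = mkℝ (λ n → - seq x n) (neg-cauchy x)

absSum : (ℕ → ℚ) → ℕ → ℚ
absSum x zero    = 0ℚ
absSum x (suc n) = absSum x n + ∣ x n ∣

absSum-0≤ : ∀ x n → 0ℚ ≤ absSum x n
absSum-0≤ x zero    = ≤-refl
absSum-0≤ x (suc n) = +-0≤ (absSum-0≤ x n) (0≤∣p∣ (x n))

absSum-bounds : ∀ x n k → k ℕ.< n → ∣ x k ∣ ≤ absSum x n
absSum-bounds x (suc n) k (s≤s k≤n) with ℕ.m≤n⇒m<n∨m≡n k≤n
... | inj₁ k<n = ≤-trans (absSum-bounds x n k k<n)
  (p≤p+q (absSum x n) (0≤∣p∣ (x n)))
... | inj₂ refl = subst (_≤ absSum x n + ∣ x n ∣) (+-identityˡ ∣ x n ∣)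
    (+-monoˡ-≤ ∣ x n ∣ (absSum-0≤ x n))

bounded : ∀ x → ∃[ B ] 0ℚ < B × ∀ n → ∣ seq x n ∣ ≤ B
bounded x = B , 0<B , below
  where
  1>0 = positive⁻¹ 1ℚ
  N = proj₁ (cauchy x 1ℚ 1>0)
  S = absSum (seq x) (suc N)
  B = 1ℚ + S
  0<B : 0ℚ < B
  0<B = +-mono-<-≤ 1>0 (absSum-0≤ (seq x) (suc N))
  below : ∀ n → ∣ seq x n ∣ ≤ B
  below n with ℕ.≤-<-connex N n
  ... | inj₂ n<N = ≤-trans (absSum-bounds (seq x) (suc N) n (ℕ.m<n⇒m<1+n n<N))
    (subst (_≤ B) (+-identityˡ S) (+-monoˡ-≤ S (<⇒≤ 1>0)))
  ... | inj₁ N≤n = ≤-trans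
    (subst (_≤ ∣ seq x n - seq x N ∣ + ∣ seq x N ∣)
      (cong ∣_∣ (solve 2 (λ a b → (a :- b) :+ b := a) refl (seq x n) (seq x N)))
      (∣p+q∣≤∣p∣+∣q∣ (seq x n - seq x N) (seq x N)))
    (+-mono-≤ (<⇒≤ (proj₂ (cauchy x 1ℚ 1>0) n N N≤n ℕ.≤-refl))
      (absSum-bounds (seq x) (suc N) N ℕ.≤-refl))

abstract
  *-cauchy : ∀ x y → IsCauchy (λ n → seq x n * seq y n)
  *-cauchy x y ε 0<ε =
    let (A , 0<A , x≤A) = bounded x
        (B , 0<B , y≤B) = bounded y
        (δ , 0<δ , eq)  = divide-by (A + B) ε (+-mono-< 0<A 0<B) 0<ε
        (M , hM) = cauchy x δ 0<δ
        (N , hN) = cauchy y δ 0<δ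
    in M ℕ.⊔ N , λ m n m≥ n≥ →
      subst (∣ seq x m * seq y m - seq x n * seq y n ∣ <_) eq
        (product-dist (seq x m) (seq y m) (seq x n) (seq y n) 0<A 0<B
          (x≤A m) (y≤B n)
          (hM m n (ℕ.m⊔n≤o⇒m≤o M N m≥) (ℕ.m⊔n≤o⇒m≤o M N n≥))
          (hN m n (ℕ.m⊔n≤o⇒n≤o M N m≥) (ℕ.m⊔n≤o⇒n≤o M N n≥)))

_*ℝ_ : ℝ → ℝ → ℝ
x *ℝ y = mkℝ (λ n → seq x n * seq y n) (*-cauchy x y)

_^ℝ_ : ℝ → ℕ → ℝ
x ^ℝ zero  = 1ℝ
x ^ℝ suc n = x *ℝ x ^ℝ n

-- The value at 0 is never used in the limit: only finitely many terms of a
-- positive real vanish.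
invℚ : ℚ → ℚ
invℚ q with q ≟ 0ℚ
... | yes _  = 0ℚ
... | no q≢0 = (1/ q) {{≢-nonZero q≢0}}

invℚ-inverse : ∀ q → 0ℚ < q → q * invℚ q ≡ 1ℚ
invℚ-inverse q 0<q with q ≟ 0ℚ
... | yes q≡0 = contradiction (sym q≡0) (<⇒≢ 0<q)
... | no q≢0  = *-inverseʳ q {{≢-nonZero q≢0}}

inv-dist : ∀ {γ η} a b → 0ℚ < γ → γ ≤ a → γ ≤ b → ∣ a - b ∣ < γ * γ * η →
  ∣ invℚ a - invℚ b ∣ < η
inv-dist {γ} {η} a b 0<γ γ≤a γ≤b h =
  *-cancelˡ-<-nonNeg (γ * γ) {{nonNegative 0≤γγ}} (≤-<-trans below h)
  where
  0≤γ = <⇒≤ 0<γ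
  0≤γγ = *-0≤ 0≤γ 0≤γ
  0<a = <-≤-trans 0<γ γ≤a
  0<b = <-≤-trans 0<γ γ≤b
  0≤ab = *-0≤ (<⇒≤ 0<a) (<⇒≤ 0<b)
  u = invℚ a
  v = invℚ b
  eq : a * b * (u - v) ≡ b - a
  eq = trans
    (solve 4 (λ a b u v → a :* b :* (u :- v) := b :* (a :* u) :- a :* (b :* v))
      refl a b u v)
    (trans (cong₂ (λ p q → b * p - a * q) (invℚ-inverse a 0<a) (invℚ-inverse b 0<b))
      (cong₂ _-_ (*-identityʳ b) (*-identityʳ a)))
  below : γ * γ * ∣ u - v ∣ ≤ ∣ a - b ∣
  below = subst (γ * γ * ∣ u - v ∣ ≤_)
    (trans (cong (_* ∣ u - v ∣) (sym (0≤p⇒∣p∣≡p 0≤ab)))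
      (trans (sym (∣p*q∣≡∣p∣*∣q∣ (a * b) (u - v)))
        (trans (cong ∣_∣ eq) (dist-sym b a))))
    (*-monoʳ-≤-nonNeg ∣ u - v ∣ {{∣-∣-nonNeg (u - v)}}
      (*-mono-≤-nonNeg 0≤γ (<⇒≤ 0<b) γ≤a γ≤b))

abstract
  inv-cauchy : ∀ x → 0ℝ <ℝ x → IsCauchy (λ n → invℚ (seq x n))
  inv-cauchy x (mk< γ 0<γ (M , above)) ε 0<ε =
    let (N , hN) = cauchy x (γ * γ * ε) (0<*⁺ (0<*⁺ 0<γ 0<γ) 0<ε)
        γ≤ = λ n M≤n → subst (_≤ seq x n) (+-identityˡ γ) (above n M≤n)
    in M ℕ.⊔ N , λ m n m≥ n≥ →
      inv-dist (seq x m) (seq x n) 0<γ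
        (γ≤ m (ℕ.m⊔n≤o⇒m≤o M N m≥)) (γ≤ n (ℕ.m⊔n≤o⇒m≤o M N n≥))
        (hN m n (ℕ.m⊔n≤o⇒n≤o M N m≥) (ℕ.m⊔n≤o⇒n≤o M N n≥))

inverse⁺ : ∀ x → 0ℝ <ℝ x → ℝ
inverse⁺ x 0<x = mkℝ (λ n → invℚ (seq x n)) (inv-cauchy x 0<x)

cosCoeff : ℕ → ℚ
cosCoeff k = (ℤ.-1ℤ ℤ.^ k / (2 ℕ.* k) !) {{(2 ℕ.* k) !≢0}}

cosSum : ℕ → ℝ → ℝ
cosSum zero    x = 0ℝ
cosSum (suc n) x = cosSum n x +ℝ fromℚ (cosCoeff n) *ℝ x ^ℝ (2 ℕ.* n)

infixr 8 _^ℚ_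

_^ℚ_ : ℚ → ℕ → ℚ
q ^ℚ zero  = 1ℚ
q ^ℚ suc n = q * q ^ℚ n

cosSumℚ : ℕ → ℚ → ℚ
cosSumℚ zero    q = 0ℚ
cosSumℚ (suc n) q = cosSumℚ n q + cosCoeff n * q ^ℚ (2 ℕ.* n)

seq-^ : ∀ x n m → seq (x ^ℝ n) m ≡ seq x m ^ℚ n
seq-^ x zero    m = refl
seq-^ x (suc n) m = cong (seq x m *_) (seq-^ x n m)

seq-cosSum : ∀ n x m → seq (cosSum n x) m ≡ cosSumℚ n (seq x m)
seq-cosSum zero    x m = refl
seq-cosSum (suc n) x m =
  cong₂ _+_ (seq-cosSum n x m) (cong (cosCoeff n *_) (seq-^ x (2 ℕ.* n) m))

fromℕ : ℕ → ℚ
fromℕ m = + m / 1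

toℚᵘ-/ : ∀ i n .{{_ : ℕ.NonZero n}} → toℚᵘ (i / n) ℚᵘ.≃ (i ℚᵘ./ n)
toℚᵘ-/ i (suc n) = toℚᵘ-fromℚᵘ (ℚᵘ.mkℚᵘ i n)

fromℕ-mono : ∀ {m n} → m ℕ.≤ n → fromℕ m ≤ fromℕ n
fromℕ-mono {m} {n} m≤n = toℚᵘ-cancel-≤
  (ℚᵘ.≤-respˡ-≃ (ℚᵘ.≃-sym (toℚᵘ-/ (+ m) 1))
    (ℚᵘ.≤-respʳ-≃ (ℚᵘ.≃-sym (toℚᵘ-/ (+ n) 1))
      (ℚᵘ.*≤* (ℤ.*-monoʳ-≤-nonNeg (+ 1) (+≤+ m≤n)))))

fromℕ-* : ∀ m n → fromℕ (m ℕ.* n) ≡ fromℕ m * fromℕ n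
fromℕ-* m n = toℚᵘ-injective
  (ℚᵘ.≃-trans (toℚᵘ-/ (+ (m ℕ.* n)) 1)
    (ℚᵘ.≃-trans (ℚᵘ.≃-reflexive (cong (λ i → ℚᵘ.mkℚᵘ i 0) (ℤ.pos-* m n)))
      (ℚᵘ.≃-sym (ℚᵘ.≃-trans (toℚᵘ-homo-* (fromℕ m) (fromℕ n))
        (ℚᵘ.*-cong (toℚᵘ-/ (+ m) 1) (toℚᵘ-/ (+ n) 1))))))

fromℕ-suc : ∀ m → fromℕ (suc m) ≡ 1ℚ + fromℕ m
fromℕ-suc m = toℚᵘ-injective
  (ℚᵘ.≃-trans (toℚᵘ-/ (+ suc m) 1)
    (ℚᵘ.≃-trans (ℚᵘ.*≡* (ℤ-eq (+ m)))
      (ℚᵘ.≃-sym (ℚᵘ.≃-trans (toℚᵘ-homo-+ 1ℚ (fromℕ m))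
        (ℚᵘ.+-cong (ℚᵘ.≃-refl {ℚᵘ.1ℚᵘ}) (toℚᵘ-/ (+ m) 1))))))
  where
  ℤ-eq : ∀ i → (+ 1 ℤ.+ i) ℤ.* + 1 ≡ (+ 1 ℤ.* + 1 ℤ.+ i ℤ.* + 1) ℤ.* + 1
  ℤ-eq = ℤ-solve-∀

fromℕ-0≤ : ∀ m → 0ℚ ≤ fromℕ m
fromℕ-0≤ m = fromℕ-mono {0} {m} z≤n

archimedean : ∀ q → ∃[ N ] q ≤ fromℕ N
archimedean q@(mkℚ i d _) = ℤ.∣ i ∣ , toℚᵘ-cancel-≤
  (ℚᵘ.≤-respʳ-≃ (ℚᵘ.≃-sym (toℚᵘ-/ (+ ℤ.∣ i ∣) 1)) (ℚᵘ.*≤* (le i)))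
  where
  le : ∀ i → i ℤ.* + 1 ℤ.≤ + ℤ.∣ i ∣ ℤ.* + suc d
  le (+ n)    = subst₂ ℤ._≤_ (ℤ.pos-* n 1) (ℤ.pos-* n (suc d))
    (+≤+ (ℕ.*-monoʳ-≤ n (s≤s z≤n)))
  le -[1+ n ] = -≤+

2·suc : ∀ k → 2 ℕ.* suc k ≡ suc (suc (2 ℕ.* k))
2·suc k = ℕ.*-suc 2 k

growth : ℕ → ℕ
growth k = suc (suc (2 ℕ.* k)) ℕ.* suc (2 ℕ.* k)

!-step : ∀ k → (2 ℕ.* suc k) ! ≡ growth k ℕ.* (2 ℕ.* k) !
!-step k = trans (cong _! (2·suc k))
  (sym (ℕ.*-assoc (suc (suc (2 ℕ.* k))) (suc (2 ℕ.* k)) ((2 ℕ.* k) !)))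

/-step : ∀ i n n′ m .{{_ : ℕ.NonZero n}} .{{_ : ℕ.NonZero n′}} → n′ ≡ m ℕ.* n →
  (ℤ.-1ℤ ℤ.* i / n′) * fromℕ m ≡ - (i / n)
/-step i n@(suc _) n′@(suc _) m eq = toℚᵘ-injective
  (ℚᵘ.≃-trans
    (ℚᵘ.≃-trans (toℚᵘ-homo-* (ℤ.-1ℤ ℤ.* i / n′) (fromℕ m))
      (ℚᵘ.*-cong (toℚᵘ-/ (ℤ.-1ℤ ℤ.* i) n′) (toℚᵘ-/ (+ m) 1)))
    (ℚᵘ.≃-trans (ℚᵘ.*≡* cross)
      (ℚᵘ.≃-sym (ℚᵘ.≃-trans (toℚᵘ-homo‿- (i / n)) (ℚᵘ.-‿cong (toℚᵘ-/ i n))))))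
  where
  ℤ-eq : ∀ i m n → ℤ.-1ℤ ℤ.* i ℤ.* m ℤ.* n ≡ ℤ.- i ℤ.* (m ℤ.* n ℤ.* + 1)
  ℤ-eq = ℤ-solve-∀
  cross : ℤ.-1ℤ ℤ.* i ℤ.* + m ℤ.* + n ≡ ℤ.- i ℤ.* + (n′ ℕ.* 1)
  cross = trans (ℤ-eq i (+ m) (+ n)) (cong (ℤ.- i ℤ.*_)
    (trans (cong (ℤ._* + 1) (sym (trans (cong +_ eq) (ℤ.pos-* m n))))
      (sym (ℤ.pos-* n′ 1))))

cosCoeff-step : ∀ k → ∣ cosCoeff (suc k) ∣ * fromℕ (growth k) ≡ ∣ cosCoeff k ∣
cosCoeff-step k = trans
  (cong (∣ cosCoeff (suc k) ∣ *_) (sym (0≤p⇒∣p∣≡p (fromℕ-0≤ (growth k)))))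
  (trans (sym (∣p*q∣≡∣p∣*∣q∣ (cosCoeff (suc k)) (fromℕ (growth k))))
    (trans (cong ∣_∣ (/-step (ℤ.-1ℤ ℤ.^ k) ((2 ℕ.* k) !) ((2 ℕ.* suc k) !) (growth k)
      {{(2 ℕ.* k) !≢0}} {{(2 ℕ.* suc k) !≢0}} (!-step k)))
      (∣-p∣≡∣p∣ (cosCoeff k))))

2ℚ : ℚ
2ℚ = + 2 / 1

growth-bound : ∀ {B} k → 0ℚ ≤ B → B ≤ fromℕ k → 2ℚ * (B * B) ≤ fromℕ (growth k)
growth-bound {B} k 0≤B B≤k = ≤-trans
  (*-monoˡ-≤-nonNeg 2ℚ (*-mono-≤-nonNeg 0≤B (fromℕ-0≤ k) B≤k B≤k))
  (subst (_≤ fromℕ (growth k))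
    (trans (fromℕ-* 2 (k ℕ.* k)) (cong (2ℚ *_) (fromℕ-* k k)))
    (fromℕ-mono (ℕ.≤-trans (ℕ.≤-reflexive (sym (ℕ.*-assoc 2 k k)))
      (ℕ.*-mono-≤ {2 ℕ.* k} {suc (suc (2 ℕ.* k))} {k} {suc (2 ℕ.* k)}
        (ℕ.≤-trans (ℕ.n≤1+n _) (ℕ.n≤1+n _))
        (ℕ.≤-trans (ℕ.m≤n*m k 2) (ℕ.n≤1+n _))))))

majorant : ℚ → ℕ → ℚ
majorant B k = ∣ cosCoeff k ∣ * B ^ℚ (2 ℕ.* k)

^ℚ-0≤ : ∀ {B} n → 0ℚ ≤ B → 0ℚ ≤ B ^ℚ n
^ℚ-0≤ zero    0≤B = <⇒≤ (positive⁻¹ 1ℚ)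
^ℚ-0≤ (suc n) 0≤B = *-0≤ 0≤B (^ℚ-0≤ n 0≤B)

^ℚ-bound : ∀ {B q} n → 0ℚ ≤ B → ∣ q ∣ ≤ B → ∣ q ^ℚ n ∣ ≤ B ^ℚ n
^ℚ-bound zero    0≤B q≤B = ≤-refl
^ℚ-bound {B} {q} (suc n) 0≤B q≤B = subst (_≤ B * B ^ℚ n)
  (sym (∣p*q∣≡∣p∣*∣q∣ q (q ^ℚ n)))
  (*-mono-≤-nonNeg (0≤∣p∣ q) (^ℚ-0≤ n 0≤B) q≤B (^ℚ-bound n 0≤B q≤B))

majorant-0≤ : ∀ {B} k → 0ℚ ≤ B → 0ℚ ≤ majorant B k
majorant-0≤ k 0≤B = *-0≤ (0≤∣p∣ (cosCoeff k)) (^ℚ-0≤ (2 ℕ.* k) 0≤B)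

majorant-step : ∀ {B} k → 0ℚ ≤ B → B ≤ fromℕ k →
  majorant B (suc k) + majorant B (suc k) ≤ majorant B k
majorant-step {B} k 0≤B B≤k = subst₂ _≤_ lhs rhs
  (*-monoˡ-≤-nonNeg c {{∣-∣-nonNeg (cosCoeff (suc k))}}
    (*-monoʳ-≤-nonNeg P {{nonNegative (^ℚ-0≤ (2 ℕ.* k) 0≤B)}}
      (growth-bound k 0≤B B≤k)))
  where
  c = ∣ cosCoeff (suc k) ∣
  P = B ^ℚ (2 ℕ.* k)
  lhs : c * (2ℚ * (B * B) * P) ≡ majorant B (suc k) + majorant B (suc k)
  lhs = trans
    (solve 3 (λ c B P → c :* (con 2ℚ :* (B :* B) :* P)
      := c :* (B :* (B :* P)) :+ c :* (B :* (B :* P))) refl c B P)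
    (cong (λ e → c * B ^ℚ e + c * B ^ℚ e) (sym (2·suc k)))
  rhs : c * (fromℕ (growth k) * P) ≡ majorant B k
  rhs = trans (sym (*-assoc c (fromℕ (growth k)) P)) (cong (_* P) (cosCoeff-step k))

tail-bound : ∀ {B q} N → 0ℚ ≤ B → B ≤ fromℕ N → ∣ q ∣ ≤ B → ∀ j →
  ∣ cosSumℚ (j ℕ.+ N) q - cosSumℚ N q ∣ + (majorant B (j ℕ.+ N) + majorant B (j ℕ.+ N))
    ≤ majorant B N + majorant B N
tail-bound {B} {q} N 0≤B B≤N q≤B zero = ≤-reflexive
  (trans (cong (λ d → ∣ d ∣ + (majorant B N + majorant B N)) (+-inverseʳ (cosSumℚ N q)))
    (+-identityˡ _))
tail-bound {B} {q} N 0≤B B≤N q≤B (suc j) = ≤-trans step (tail-bound N 0≤B B≤N q≤B j)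
  where
  k = j ℕ.+ N
  S = cosSumℚ k q
  S₀ = cosSumℚ N q
  t = cosCoeff k * q ^ℚ (2 ℕ.* k)
  u = majorant B k
  u′ = majorant B (suc k)
  t≤u : ∣ t ∣ ≤ u
  t≤u = subst (_≤ u) (sym (∣p*q∣≡∣p∣*∣q∣ (cosCoeff k) (q ^ℚ (2 ℕ.* k))))
    (*-monoˡ-≤-nonNeg ∣ cosCoeff k ∣ {{∣-∣-nonNeg (cosCoeff k)}} (^ℚ-bound (2 ℕ.* k) 0≤B q≤B))
  u′≤u : u′ + u′ ≤ u
  u′≤u = majorant-step k 0≤B (≤-trans B≤N (fromℕ-mono (ℕ.m≤n+m N j)))
  step : ∣ (S + t) - S₀ ∣ + (u′ + u′) ≤ ∣ S - S₀ ∣ + (u + u)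
  step = subst (∣ (S + t) - S₀ ∣ + (u′ + u′) ≤_)
    (+-assoc ∣ S - S₀ ∣ u u)
    (+-mono-≤
      (≤-trans
        (subst (_≤ ∣ S - S₀ ∣ + ∣ t ∣)
          (cong ∣_∣ (solve 3 (λ S t S₀ → (S :- S₀) :+ t := (S :+ t) :- S₀) refl S t S₀))
          (∣p+q∣≤∣p∣+∣q∣ (S - S₀) t))
        (+-monoʳ-≤ ∣ S - S₀ ∣ t≤u))
      u′≤u)

majorant-decay : ∀ {B} N → 0ℚ ≤ B → B ≤ fromℕ N → ∀ j →
  fromℕ (suc j) * majorant B (j ℕ.+ N) ≤ majorant B N
majorant-decay {B} N 0≤B B≤N zero    = ≤-reflexive (*-identityˡ (majorant B N))
majorant-decay {B} N 0≤B B≤N (suc j) = ≤-trans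
  (*-monoʳ-≤-nonNeg u′ {{nonNegative (majorant-0≤ (suc k) 0≤B)}} double)
  (≤-trans
    (subst (_≤ m * u) (solve 2 (λ m u → m :* (u :+ u) := (m :+ m) :* u) refl m u′)
      (*-monoˡ-≤-nonNeg m {{nonNegative (fromℕ-0≤ (suc j))}}
        (majorant-step k 0≤B (≤-trans B≤N (fromℕ-mono (ℕ.m≤n+m N j))))))
    (majorant-decay N 0≤B B≤N j))
  where
  k = j ℕ.+ N
  m = fromℕ (suc j)
  u = majorant B k
  u′ = majorant B (suc k)
  double : fromℕ (suc (suc j)) ≤ m + m
  double = subst (_≤ m + m) (sym (fromℕ-suc (suc j)))
    (+-monoˡ-≤ m (fromℕ-mono {1} {suc j} (s≤s z≤n)))

majorant-small : ∀ B ε → 0ℚ ≤ B → 0ℚ < ε →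
  ∃[ N ] B ≤ fromℕ N × majorant B N ≤ ε
majorant-small B ε 0≤B 0<ε =
  j ℕ.+ N , ≤-trans B≤N (fromℕ-mono (ℕ.m≤n+m N j)) ,
  *-cancelˡ-≤-pos m {{positive 0<m}}
    (≤-trans (majorant-decay N 0≤B B≤N j)
      (≤-trans (subst (_≤ ε * fromℕ j) eq
          (*-monoˡ-≤-nonNeg ε {{nonNegative (<⇒≤ 0<ε)}} q≤j))
        (subst (ε * fromℕ j ≤_) (*-comm ε m)
          (*-monoˡ-≤-nonNeg ε {{nonNegative (<⇒≤ 0<ε)}} (fromℕ-mono (ℕ.n≤1+n j))))))
  where
  N = proj₁ (archimedean B)
  B≤N = proj₂ (archimedean B)
  1/ε = (1/ ε) {{pos⇒nonZero ε {{positive 0<ε}}}}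
  q = 1/ε * majorant B N
  j = proj₁ (archimedean q)
  q≤j = proj₂ (archimedean q)
  m = fromℕ (suc j)
  0<m : 0ℚ < m
  0<m = <-≤-trans (positive⁻¹ 1ℚ) (fromℕ-mono {1} {suc j} (s≤s z≤n))
  eq : ε * q ≡ majorant B N
  eq = trans (sym (*-assoc ε 1/ε (majorant B N)))
    (trans (cong (_* majorant B N) (*-inverseʳ ε {{pos⇒nonZero ε {{positive 0<ε}}}}))
      (*-identityˡ (majorant B N)))

abstract
  cosSumℚ-uniform : ∀ B ε → 0ℚ ≤ B → 0ℚ < ε →
    ∃[ N ] ∀ q → ∣ q ∣ ≤ B → ∀ n → N ℕ.≤ n → ∣ cosSumℚ n q - cosSumℚ N q ∣ ≤ ε
  cosSumℚ-uniform B ε 0≤B 0<ε =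
    let (N , B≤N , small) = majorant-small B (½ * ε) 0≤B (0<½* 0<ε)
        u≥0 = λ j → majorant-0≤ (j ℕ.+ N) 0≤B
    in N , λ q q≤B n N≤n →
      ≤-trans
        (subst (λ k → ∣ cosSumℚ k q - cosSumℚ N q ∣ ≤ majorant B N + majorant B N)
          (ℕ.m∸n+n≡m N≤n)
          (≤-trans
            (p≤p+q ∣ cosSumℚ (n ℕ.∸ N ℕ.+ N) q - cosSumℚ N q ∣
              (+-0≤ (u≥0 (n ℕ.∸ N)) (u≥0 (n ℕ.∸ N))))
            (tail-bound N 0≤B B≤N q≤B (n ℕ.∸ N))))
        (subst (majorant B N + majorant B N ≤_) (½+½ ε) (+-mono-≤ small small))

abstract
  cos-cauchy : ∀ x → IsCauchy (λ n → seq (cosSum n x) n)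
  cos-cauchy x ε 0<ε =
    let δ = ½ * (½ * ε)
        0<δ = 0<½* (0<½* 0<ε)
        (B , 0<B , bound) = bounded x
        (N , uniform) = cosSumℚ-uniform B δ (<⇒≤ 0<B) 0<δ
        (M , fixed) = cauchy (cosSum N x) (½ * ε) (0<½* 0<ε)
    in M ℕ.⊔ N , λ m n m≥ n≥ →
      subst₂ (λ a b → ∣ a - b ∣ < ε) (sym (seq-cosSum m x m)) (sym (seq-cosSum n x n))
        (dist-three-steps ε (cosSumℚ m (seq x m)) (cosSumℚ N (seq x m))
            (cosSumℚ N (seq x n)) (cosSumℚ n (seq x n))
          (uniform (seq x m) (bound m) m (ℕ.m⊔n≤o⇒n≤o M N m≥))
          (subst₂ (λ a b → ∣ a - b ∣ < ½ * ε) (seq-cosSum N x m) (seq-cosSum N x n)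
            (fixed m n (ℕ.m⊔n≤o⇒m≤o M N m≥) (ℕ.m⊔n≤o⇒m≤o M N n≥)))
          (subst (_≤ δ) (dist-sym (cosSumℚ n (seq x n)) (cosSumℚ N (seq x n)))
            (uniform (seq x n) (bound n) n (ℕ.m⊔n≤o⇒n≤o M N n≥))))

-- The limit of the partial sums cosSum n x, represented by their diagonal
-- sequence; cosSum-converges shows that this is indeed the limit.
cos : ℝ → ℝ
cos x = mkℝ (λ n → seq (cosSum n x) n) (cos-cauchy x)

infix 4 _⟶_

_⟶_ : (ℕ → ℝ) → ℝ → Set
X ⟶ l = ∀ ε → 0ℚ < ε → ∃[ N ] ∀ n → N ℕ.≤ n →
  (X n <ℝ l +ℝ fromℚ ε) × (l <ℝ X n +ℝ fromℚ ε)

dist<⇒gap : ∀ ε a b → ∣ a - b ∣ < ½ * ε → a + ½ * ε ≤ b + ε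
dist<⇒gap ε a b h = subst₂ _≤_
  (solve 3 (λ a b δ → (a :- b) :+ (b :+ δ) := a :+ δ) refl a b (½ * ε))
  (trans (solve 2 (λ b δ → δ :+ (b :+ δ) := b :+ (δ :+ δ)) refl b (½ * ε))
    (cong (λ e → b + e) (½+½ ε)))
  (+-monoˡ-≤ (b + ½ * ε) (≤-trans (p≤∣p∣ (a - b)) (<⇒≤ h)))
  where
  p≤∣p∣ : ∀ p → p ≤ ∣ p ∣
  p≤∣p∣ p with ≤-total 0ℚ p
  ... | inj₁ 0≤p = ≤-reflexive (sym (0≤p⇒∣p∣≡p 0≤p))
  ... | inj₂ p≤0 = ≤-trans p≤0 (0≤∣p∣ p)

cosSum-near : ∀ x ε → 0ℚ < ε → ∃[ N ] ∀ n m → N ℕ.≤ n → N ℕ.≤ m →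
  ∣ seq (cosSum n x) m - seq (cosSum m x) m ∣ < ε
cosSum-near x ε 0<ε = N , λ n m n≥ m≥ →
  subst₂ (λ a b → ∣ a - b ∣ < ε) (sym (seq-cosSum n x m)) (sym (seq-cosSum m x m))
    (dist-three-steps ε (cosSumℚ n (seq x m)) (cosSumℚ N (seq x m))
      (cosSumℚ N (seq x m)) (cosSumℚ m (seq x m))
      (uniform (seq x m) (bound m) n n≥)
      (dist-refl (cosSumℚ N (seq x m)) (0<½* 0<ε))
      (subst (_≤ δ) (dist-sym (cosSumℚ m (seq x m)) (cosSumℚ N (seq x m)))
        (uniform (seq x m) (bound m) m m≥)))
  where
  δ = ½ * (½ * ε)
  B = proj₁ (bounded x)
  0<B = proj₁ (proj₂ (bounded x))
  bound = proj₂ (proj₂ (bounded x))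
  found = cosSumℚ-uniform B δ (<⇒≤ 0<B) (0<½* (0<½* 0<ε))
  N = proj₁ found
  uniform = proj₂ found

cosSum-converges : ∀ x → (λ n → cosSum n x) ⟶ cos x
cosSum-converges x ε 0<ε = N , λ n n≥ →
    mk< (½ * ε) 0<½ε (N , λ m m≥ →
      dist<⇒gap ε (seq (cosSum n x) m) (seq (cosSum m x) m) (near n m n≥ m≥)) ,
    mk< (½ * ε) 0<½ε (N , λ m m≥ →
      dist<⇒gap ε (seq (cosSum m x) m) (seq (cosSum n x) m)
        (subst (_< ½ * ε) (dist-sym (seq (cosSum n x) m) (seq (cosSum m x) m))
          (near n m n≥ m≥)))
  where
  0<½ε = 0<½* 0<ε
  N = proj₁ (cosSum-near x (½ * ε) 0<½ε)
  near = proj₂ (cosSum-near x (½ * ε) 0<½ε)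

-- π/2 is the least positive zero of the cosine.
record IsPi (π : ℝ) : Set where
  field
    positive-π : 0ℝ <ℝ π
    zero-π/2   : cos (fromℚ ½ *ℝ π) ≈ℝ 0ℝ
    least      : ∀ x → 0ℝ <ℝ x → x <ℝ fromℚ ½ *ℝ π → ¬ (cos x ≈ℝ 0ℝ)

infix 5 _+i_

record ℂ : Set where
  constructor _+i_
  field
    re im : ℝ

open ℂ public

infix 4 _≈ℂ_

record _≈ℂ_ (z w : ℂ) : Set where
  constructor mk≈ℂ
  field
    re-≈ : re z ≈ℝ re w
    im-≈ : im z ≈ℝ im w

ofℝ : ℝ → ℂ
ofℝ x = x +i 0ℝ

ofℚ : ℚ → ℂ
ofℚ q = ofℝ (fromℚ q)

0ℂ 𝕚 : ℂ
0ℂ = ofℚ 0ℚ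
𝕚  = 0ℝ +i 1ℝ

infixl 6 _+ℂ_
infixl 7 _*ℂ_

_+ℂ_ _*ℂ_ : ℂ → ℂ → ℂ
z +ℂ w = (re z +ℝ re w) +i (im z +ℝ im w)
z *ℂ w = (re z *ℝ re w +ℝ (-ℝ (im z *ℝ im w))) +i (re z *ℝ im w +ℝ im z *ℝ re w)

normSq : ℂ → ℝ
normSq z = re z *ℝ re z +ℝ im z *ℝ im z

-- Nonvanishing in the sense of constructive analysis (apartness from 0), as is
-- needed for division.
_≠0 : ℂ → Set
z ≠0 = 0ℝ <ℝ normSq z

inverseℂ : ∀ z → z ≠0 → ℂ
inverseℂ z z≠0 = (re z *ℝ r) +i (-ℝ (im z *ℝ r))
  where r = inverse⁺ (normSq z) z≠0

_/ℂ_⟨_⟩ : (z w : ℂ) → w ≠0 → ℂ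
z /ℂ w ⟨ w≠0 ⟩ = z *ℂ inverseℂ w w≠0

record SquareRoot (z : ℂ) : Set where
  constructor mk√
  field
    root  : ℂ
    sq-≈z : root *ℂ root ≈ℂ z

open SquareRoot public

*ℝ-cong : ∀ {x x′ y y′} → x ≈ℝ x′ → y ≈ℝ y′ → x *ℝ y ≈ℝ x′ *ℝ y′
*ℝ-cong {x} {x′} {y} {y′} (mk≈ p) (mk≈ q) = mk≈ λ ε 0<ε →
  let (A , 0<A , x≤A)  = bounded x
      (B , 0<B , y′≤B) = bounded y′
      (δ , 0<δ , eq)   = divide-by (A + B) ε (+-mono-< 0<A 0<B) 0<ε
      (M , hM) = p δ 0<δ
      (N , hN) = q δ 0<δ
  in M ℕ.⊔ N , λ n n≥ →
    subst (∣ seq x n * seq y n - seq x′ n * seq y′ n ∣ <_) eq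
      (product-dist (seq x n) (seq y n) (seq x′ n) (seq y′ n) 0<A 0<B
        (x≤A n) (y′≤B n)
        (hM n (ℕ.m⊔n≤o⇒m≤o M N n≥)) (hN n (ℕ.m⊔n≤o⇒n≤o M N n≥)))

+ℝ-cong : ∀ {x x′ y y′} → x ≈ℝ x′ → y ≈ℝ y′ → x +ℝ y ≈ℝ x′ +ℝ y′
+ℝ-cong {x} {x′} {y} {y′} (mk≈ p) (mk≈ q) = mk≈ λ ε 0<ε →
  let (M , hM) = p (½ * ε) (0<½* 0<ε)
      (N , hN) = q (½ * ε) (0<½* 0<ε)
  in M ℕ.⊔ N , λ n n≥ →
    sum-dist ε (seq x n) (seq y n) (seq x′ n) (seq y′ n)
      (hM n (ℕ.m⊔n≤o⇒m≤o M N n≥)) (hN n (ℕ.m⊔n≤o⇒n≤o M N n≥))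

<ℝ-respʳ-≈ : ∀ {x y} → y ≈ℝ x → 0ℝ <ℝ x → 0ℝ <ℝ y
<ℝ-respʳ-≈ {x} {y} (mk≈ p) (mk< γ 0<γ (M , above)) =
  let (N , hN) = p (½ * γ) (0<½* 0<γ) in
  mk< (½ * γ) (0<½* 0<γ) (M ℕ.⊔ N , λ n n≥ →
    lower (seq y n) (seq x n)
      (hN n (ℕ.m⊔n≤o⇒n≤o M N n≥)) (above n (ℕ.m⊔n≤o⇒m≤o M N n≥)))
  where
  lower : ∀ b a → ∣ b - a ∣ < ½ * γ → 0ℚ + γ ≤ a → 0ℚ + ½ * γ ≤ b
  lower b a h γ≤a = subst₂ _≤_
    (solve 2 (λ γ δ → (con 0ℚ :+ γ) :+ (δ :+ (:- γ)) := con 0ℚ :+ δ) refl γ (½ * γ))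
    (solve 2 (λ b γ → (b :+ γ) :+ (:- γ) := b) refl b γ)
    (≤-trans
      (subst (_≤ a + (½ * γ + - γ)) refl (+-monoˡ-≤ (½ * γ + - γ) γ≤a))
      (subst (_≤ (b + γ) + - γ) (+-assoc a (½ * γ) (- γ))
        (+-monoˡ-≤ (- γ) (dist<⇒gap γ a b (subst (_< ½ * γ) (dist-sym b a) h)))))

square-positive : ∀ x → (∀ n → 0ℚ ≤ seq x n) → 0ℝ <ℝ x *ℝ x → 0ℝ <ℝ x
square-positive x 0≤x (mk< γ 0<γ (N , above)) =
  mk< (γ ⊓ 1ℚ) 0<γ⊓1 (N , λ n n≥ → subst (_≤ seq x n) (sym (+-identityˡ (γ ⊓ 1ℚ)))
    (root-bound (seq x n) (0≤x n) (subst (_≤ _) (+-identityˡ γ) (above n n≥))))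
  where
  0<γ⊓1 : 0ℚ < γ ⊓ 1ℚ
  0<γ⊓1 with ≤-total γ 1ℚ
  ... | inj₁ γ≤1 = subst (0ℚ <_) (sym (p≤q⇒p⊓q≡p γ≤1)) 0<γ
  ... | inj₂ 1≤γ = subst (0ℚ <_) (sym (p≥q⇒p⊓q≡q 1≤γ)) (positive⁻¹ 1ℚ)
  root-bound : ∀ q → 0ℚ ≤ q → γ ≤ q * q → γ ⊓ 1ℚ ≤ q
  root-bound q 0≤q γ≤qq = ≮⇒≥ λ q<γ⊓1 → <⇒≱′
    (≤-<-trans
      (subst (q * q ≤_) (*-identityʳ q)
        (*-monoˡ-≤-nonNeg q {{nonNegative 0≤q}}
          (≤-trans (<⇒≤ q<γ⊓1) (p⊓q≤q γ 1ℚ))))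
      (<-≤-trans q<γ⊓1 (p⊓q≤p γ 1ℚ)))
    γ≤qq
    where
    <⇒≱′ : ∀ {a b} → a < b → ¬ (b ≤ a)
    <⇒≱′ a<b b≤a = <-irrefl refl (<-≤-trans a<b b≤a)

root-≠0 : ∀ {z} → z ≠0 → (s : SquareRoot z) → root s ≠0
root-≠0 {z} z≠0 (mk√ s (mk≈ℂ re≈ im≈)) = square-positive (normSq s)
  (λ n → +-0≤ (square-0≤ (seq (re s) n)) (square-0≤ (seq (im s) n)))
  (<ℝ-respʳ-≈ norm≈ z≠0)
  where
  pointwise : ∀ {x y} → (∀ n → seq x n ≡ seq y n) → ∀ {w} → y ≈ℝ w → x ≈ℝ w
  pointwise {x} {y} eq {w} (mk≈ p) = mk≈ λ ε 0<ε → let (N , h) = p ε 0<ε in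
    N , λ n n≥ → subst (λ q → ∣ q - seq w n ∣ < ε) (sym (eq n)) (h n n≥)
  norm≈ : normSq s *ℝ normSq s ≈ℝ normSq z
  norm≈ = pointwise {normSq s *ℝ normSq s} {normSq (s *ℂ s)}
    (λ n → solve 2 (λ a b → (a :* a :+ b :* b) :* (a :* a :+ b :* b) :=
        (a :* a :+ (:- (b :* b))) :* (a :* a :+ (:- (b :* b)))
          :+ (a :* b :+ b :* a) :* (a :* b :+ b :* a))
      refl (seq (re s) n) (seq (im s) n))
    {normSq z} (+ℝ-cong (*ℝ-cong re≈ re≈) (*ℝ-cong im≈ im≈))

-- Lists of coefficients, constant term first; trailing zeros are allowed, so
-- equality of polynomials is _≈ₚ_.
ℚ[x] : Set
ℚ[x] = List ℚ

coeff : ℚ[x] → ℕ → ℚ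
coeff []      _       = 0ℚ
coeff (a ∷ p) zero    = a
coeff (a ∷ p) (suc k) = coeff p k

infix 4 _≈ₚ_

_≈ₚ_ : ℚ[x] → ℚ[x] → Set
p ≈ₚ q = ∀ k → coeff p k ≡ coeff q k

HasDegree : ℚ[x] → ℕ → Set
HasDegree p m = coeff p m ≢ 0ℚ × (∀ k → m ℕ.< k → coeff p k ≡ 0ℚ)

constant : ℚ → ℚ[x]
constant a = a ∷ []

infixl 6 _+ₚ_
infixl 7 _*ₚ_ _·ₚ_

_+ₚ_ : ℚ[x] → ℚ[x] → ℚ[x]
[]      +ₚ q       = q
(a ∷ p) +ₚ []      = a ∷ p
(a ∷ p) +ₚ (b ∷ q) = (a + b) ∷ (p +ₚ q)

_·ₚ_ : ℚ → ℚ[x] → ℚ[x]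
a ·ₚ p = map (a *_) p

_*ₚ_ : ℚ[x] → ℚ[x] → ℚ[x]
[]      *ₚ q = []
(a ∷ p) *ₚ q = a ·ₚ q +ₚ (0ℚ ∷ p *ₚ q)

eval : ℚ[x] → ℂ → ℂ
eval []      t = 0ℂ
eval (a ∷ p) t = ofℚ a +ℂ t *ℂ eval p t

IsRoot : ℂ → ℚ[x] → Set
IsRoot t p = eval p t ≈ℂ 0ℂ

data InitialValue : ℚ → Set where
  +1ᵢ : InitialValue 1ℚ
  -1ᵢ : InitialValue (- 1ℚ)
  +2ᵢ : InitialValue 2ℚ
  -2ᵢ : InitialValue (- 2ℚ)

initialValue-nonZero : ∀ {p₀} → InitialValue p₀ → NonZero p₀
initialValue-nonZero +1ᵢ = _
initialValue-nonZero -1ᵢ = _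
initialValue-nonZero +2ᵢ = _
initialValue-nonZero -2ᵢ = _

record LucasType : Set where
  field
    d g p₁        : ℚ[x]
    p₀            : ℚ
    d≢0           : ¬ (d ≈ₚ [])
    g≢0           : ¬ (g ≈ₚ [])
    deg-g<deg-d   : ∃₂ λ m n → HasDegree d m × HasDegree g n × n ℕ.< m
    p₀∈[±1,±2]    : InitialValue p₀

  α : ℚ
  α = (2ℚ ÷ p₀) {{initialValue-nonZero p₀∈[±1,±2]}}

  field
    d≈αp₁ : d ≈ₚ α ·ₚ p₁

  𝓛 : ℕ → ℚ[x]
  𝓛 zero          = constant p₀
  𝓛 (suc zero)    = p₁
  𝓛 (suc (suc n)) = d *ₚ 𝓛 (suc n) +ₚ g *ₚ 𝓛 n

-- τⱼ = 2i cos((2j+1)π/2n)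
τ : ℝ → (n : ℕ) .{{_ : ℕ.NonZero n}} → Fin n → ℂ
τ π n j = ofℚ 2ℚ *ℂ 𝕚 *ℂ ofℝ (cos (fromℚ ratio *ℝ π))
  where
  ratio : ℚ
  ratio = (+ (2 ℕ.* toℕ j ℕ.+ 1) / (2 ℕ.* n)) {{ℕ.m*n≢0 2 n}}

module Submission where

-- Write s for the chosen square root of g(t), w = i s and θ = (2j+1)π/2n, so that
-- g(t) = -w² and d(t) = 2 w cos θ. Then 𝓛ₘ(t) = p₀ wᵐ cos(mθ) by induction on m:
-- the recurrence of 𝓛 turns into cos((m+2)θ) + cos(mθ) = 2 cos((m+1)θ) cos θ. The
-- same recurrence, started from cos(π/2) = 0, gives cos(nθ) = cos((2j+1)π/2) = 0.
-- The product formula behind it is proved on the power series: the Cauchy product of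
-- the series of cos x and cos y is half the sum of those of cos(x+y) and cos(x-y), by
-- comparing the derivatives, and the products of terms missing from the Cauchy
-- product are dominated by the tail of the series of cosh(2B), where |x|, |y| ≤ B.

open import Defs
open import Algebra using (CommutativeSemiring)
open import Algebra.Structures using (IsCommutativeMonoid)
open import Algebra.Structures.Biased using (isCommutativeMonoidˡ; isCommutativeSemiringˡ)
open import Data.Nat as ℕ using (ℕ; zero; suc; _!; NonZero)
import Data.Nat.Properties as ℕ
open import Data.Fin using (toℕ)
open import Data.Integer as ℤ using ()
import Data.Integer.Properties as ℤ
open import Data.List using ([]; _∷_)
open import Data.Rational
  using (ℚ; 0ℚ; 1ℚ; ½; ∣_∣; _+_; _*_; _-_; -_; _/_; 1/_; _≤_; _<_; positive; nonNegative)
open import Data.Rational.Properties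
open import Data.Rational.Solver using (module +-*-Solver)
import Data.Rational.Unnormalised as ℚᵘ
import Data.Rational.Unnormalised.Properties as ℚᵘ
open import Data.Product using (_,_; ∃-syntax; proj₁; proj₂)
open import Data.Sum using (inj₁; inj₂)
open import Function using (_∘_)
open import Relation.Binary using (IsEquivalence)
open import Relation.Binary.PropositionalEquality
  using (_≡_; _≗_; refl; sym; trans; cong; cong₂; subst; subst₂; module ≡-Reasoning)
import Relation.Binary.Reasoning.Setoid as SetoidReasoning
open +-*-Solver using (solve; _:+_; _:*_; _:-_; :-_; _:=_; con)

-- Cauchy products of coefficient sequences and the Euler operator.

*-cancelˡ-≡ : ∀ {p q} r → 0ℚ < r → r * p ≡ r * q → p ≡ q
*-cancelˡ-≡ r 0<r eq = ≤-antisym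
  (*-cancelˡ-≤-pos r {{positive 0<r}} (≤-reflexive eq))
  (*-cancelˡ-≤-pos r {{positive 0<r}} (≤-reflexive (sym eq)))

infix 8 _⋆_

-- The Cauchy product, with `f i * g j` summed over `i + j = m`. The recursion shifts `f`, so
-- inductions on `m` generalise over `f`.
_⋆_ : (ℕ → ℚ) → (ℕ → ℚ) → ℕ → ℚ
(f ⋆ g) zero    = f 0 * g 0
(f ⋆ g) (suc m) = f 0 * g (suc m) + ((f ∘ suc) ⋆ g) m

⋆-cong : ∀ {f f′ g g′} → f ≗ f′ → g ≗ g′ → f ⋆ g ≗ f′ ⋆ g′
⋆-cong p q zero    = cong₂ _*_ (p 0) (q 0)
⋆-cong p q (suc m) = cong₂ _+_ (cong₂ _*_ (p 0) (q (suc m))) (⋆-cong (p ∘ suc) q m)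

⋆-scaleˡ : ∀ a f g m → ((λ k → a * f k) ⋆ g) m ≡ a * (f ⋆ g) m
⋆-scaleˡ a f g zero    = *-assoc a (f 0) (g 0)
⋆-scaleˡ a f g (suc m) = trans
  (cong (a * f 0 * g (suc m) +_) (⋆-scaleˡ a (f ∘ suc) g m))
  (solve 4 (λ a x y z → a :* x :* y :+ a :* z := a :* (x :* y :+ z)) refl
    a (f 0) (g (suc m)) (((f ∘ suc) ⋆ g) m))

-- Mirror image of the defining recursion, peeling off `g 0` instead of `f 0`; commutativity follows
-- from it by induction.
⋆-sucʳ : ∀ f g m → (f ⋆ g) (suc m) ≡ (f ⋆ (g ∘ suc)) m + f (suc m) * g 0
⋆-sucʳ f g zero    = refl
⋆-sucʳ f g (suc m) = trans
  (cong (f 0 * g (suc (suc m)) +_) (⋆-sucʳ (f ∘ suc) g m))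
  (sym (+-assoc (f 0 * g (suc (suc m))) _ _))

⋆-comm : ∀ f g m → (f ⋆ g) m ≡ (g ⋆ f) m
⋆-comm f g zero    = *-comm (f 0) (g 0)
⋆-comm f g (suc m) = trans
  (cong (f 0 * g (suc m) +_) (⋆-comm (f ∘ suc) g m))
  (trans
    (solve 3 (λ x y z → x :* y :+ z := z :+ y :* x) refl
      (f 0) (g (suc m)) ((g ⋆ (f ∘ suc)) m))
    (sym (⋆-sucʳ g f m)))

⋆-scaleʳ : ∀ a f g m → (f ⋆ (λ k → a * g k)) m ≡ a * (f ⋆ g) m
⋆-scaleʳ a f g m = trans (⋆-comm f _ m)
  (trans (⋆-scaleˡ a g f m) (cong (a *_) (⋆-comm g f m)))

⋆-dropˡ : ∀ f g m → f 0 ≡ 0ℚ → (f ⋆ g) (suc m) ≡ ((f ∘ suc) ⋆ g) m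
⋆-dropˡ f g m f0≡0 = trans
  (cong (λ q → q * g (suc m) + ((f ∘ suc) ⋆ g) m) f0≡0)
  (solve 2 (λ y z → con 0ℚ :* y :+ z := z) refl (g (suc m)) (((f ∘ suc) ⋆ g) m))

-- ϑ α is the Euler operator z d/dz on the coefficients of a series Σ f k z^(2k+α).
weight : ℚ → ℕ → ℚ
weight α k = 2ℚ * fromℕ k + α

ϑ : ℚ → (ℕ → ℚ) → ℕ → ℚ
ϑ α f k = weight α k * f k

weight-suc : ∀ α k → weight α (suc k) ≡ weight (2ℚ + α) k
weight-suc α k = trans (cong (λ q → 2ℚ * q + α) (fromℕ-suc k))
  (solve 2 (λ α k → con 2ℚ :* (con 1ℚ :+ k) :+ α := con 2ℚ :* k :+ (con 2ℚ :+ α)) refl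
    α (fromℕ k))

ϑ-suc : ∀ α f k → ϑ α f (suc k) ≡ ϑ (2ℚ + α) (f ∘ suc) k
ϑ-suc α f k = cong (_* f (suc k)) (weight-suc α k)

-- In each product `f i * g j` with `i + j = m` the exponents `2i + α` and `2j + β` add up to
-- `2m + α + β`. The induction shifts `f`, which turns `α` into `2ℚ + α`.
leibniz : ∀ α β f g m →
  weight (α + β) m * (f ⋆ g) m ≡ (ϑ α f ⋆ g) m + (f ⋆ ϑ β g) m
leibniz α β f g zero =
  solve 4 (λ α β x y → (con 2ℚ :* con 0ℚ :+ (α :+ β)) :* (x :* y) :=
      (con 2ℚ :* con 0ℚ :+ α) :* x :* y :+ x :* ((con 2ℚ :* con 0ℚ :+ β) :* y)) refl
    α β (f 0) (g 0)
leibniz α β f g (suc m) = begin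
  weight (α + β) (suc m) * (x * y + z)
    ≡⟨ solve 7 (λ α β μ w x y z →
         (con 2ℚ :* μ :+ (α :+ β)) :* (x :* y :+ z) :=
         (con 2ℚ :* con 0ℚ :+ α) :* x :* y :+ x :* ((con 2ℚ :* μ :+ β) :* y)
           :+ (con 2ℚ :* μ :+ (α :+ β)) :* z) refl
         α β (fromℕ (suc m)) 0ℚ x y z ⟩
  ϑ α f 0 * y + x * ϑ β g (suc m) + weight (α + β) (suc m) * z
    ≡⟨ cong (λ q → ϑ α f 0 * y + x * ϑ β g (suc m) + q * z)
         (trans (weight-suc (α + β) m)
           (cong (λ γ → weight γ m) (sym (+-assoc 2ℚ α β)))) ⟩
  ϑ α f 0 * y + x * ϑ β g (suc m) + weight (2ℚ + α + β) m * z
    ≡⟨ cong (ϑ α f 0 * y + x * ϑ β g (suc m) +_) (leibniz (2ℚ + α) β (f ∘ suc) g m) ⟩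
  ϑ α f 0 * y + x * ϑ β g (suc m) + ((ϑ (2ℚ + α) (f ∘ suc) ⋆ g) m + ((f ∘ suc) ⋆ ϑ β g) m)
    ≡⟨ cong (λ q → ϑ α f 0 * y + x * ϑ β g (suc m) + (q + ((f ∘ suc) ⋆ ϑ β g) m))
         (⋆-cong (sym ∘ ϑ-suc α f) (λ _ → refl) m) ⟩
  ϑ α f 0 * y + x * ϑ β g (suc m) + (((ϑ α f ∘ suc) ⋆ g) m + ((f ∘ suc) ⋆ ϑ β g) m)
    ≡⟨ solve 4 (λ p q r s → p :+ q :+ (r :+ s) := (p :+ r) :+ (q :+ s)) refl
         (ϑ α f 0 * y) (x * ϑ β g (suc m))
         (((ϑ α f ∘ suc) ⋆ g) m) (((f ∘ suc) ⋆ ϑ β g) m) ⟩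
  (ϑ α f ⋆ g) (suc m) + (f ⋆ ϑ β g) (suc m) ∎
  where
  open ≡-Reasoning
  x = f 0
  y = g (suc m)
  z = ((f ∘ suc) ⋆ g) m

-- Addition formulas for a pair of an even and an odd series.

0<weight : ∀ {α} m → 0ℚ < α → 0ℚ < weight α m
0<weight m 0<α = +-mono-≤-< (*-0≤ (<⇒≤ (positive⁻¹ 2ℚ)) (fromℕ-0≤ m)) 0<α

-- With κ = -1 these are the terms of cosine and sine, with κ = 1 those of their
-- hyperbolic analogues.
module EvenOdd (evenCoeff oddCoeff : ℕ → ℚ) (κ : ℚ)
  (even-0 : evenCoeff 0 ≡ 1ℚ)
  (even-suc : ∀ k → weight 0ℚ (suc k) * evenCoeff (suc k) ≡ κ * oddCoeff k)
  (odd-even : ∀ k → weight 1ℚ k * oddCoeff k ≡ evenCoeff k)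
  where

  even odd : ℚ → ℕ → ℚ
  even z k = evenCoeff k * z ^ℚ (2 ℕ.* k)
  odd  z k = oddCoeff k * (z * z ^ℚ (2 ℕ.* k))

  even-at-suc : ∀ z k → even z (suc k) ≡ evenCoeff (suc k) * (z * (z * z ^ℚ (2 ℕ.* k)))
  even-at-suc z k = cong (λ e → evenCoeff (suc k) * z ^ℚ e) (2·suc k)

  -- The coefficient form of `z cos' z = - z sin z`, with `κ` for the sign. The constant term is
  -- annihilated, so the index drops by one.
  ϑ-even : ∀ z k → ϑ 0ℚ (even z) (suc k) ≡ κ * z * odd z k
  ϑ-even z k = begin
    w * even z (suc k)               ≡⟨ cong (w *_) (even-at-suc z k) ⟩
    w * (evenCoeff (suc k) * (z * p)) ≡⟨ sym (*-assoc w _ _) ⟩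
    w * evenCoeff (suc k) * (z * p)   ≡⟨ cong (_* (z * p)) (even-suc k) ⟩
    κ * oddCoeff k * (z * p)
      ≡⟨ solve 4 (λ κ c z p → κ :* c :* (z :* p) := κ :* z :* (c :* p)) refl
           κ (oddCoeff k) z p ⟩
    κ * z * odd z k ∎
    where
    open ≡-Reasoning
    w = weight 0ℚ (suc k)
    p = z * z ^ℚ (2 ℕ.* k)

  ϑ-odd : ∀ z k → ϑ 1ℚ (odd z) k ≡ z * even z k
  ϑ-odd z k = begin
    w * (oddCoeff k * (z * p))
      ≡⟨ solve 4 (λ w c z p → w :* (c :* (z :* p)) := z :* ((w :* c) :* p)) refl
           w (oddCoeff k) z p ⟩
    z * (w * oddCoeff k * p) ≡⟨ cong (λ c → z * (c * p)) (odd-even k) ⟩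
    z * even z k ∎
    where
    open ≡-Reasoning
    w = weight 1ℚ k
    p = z ^ℚ (2 ℕ.* k)

  ϑ-even-0 : ∀ z → ϑ 0ℚ (even z) 0 ≡ 0ℚ
  ϑ-even-0 z = *-zeroˡ (even z 0)

  ϑ-even-⋆ : ∀ z g m → (ϑ 0ℚ (even z) ⋆ g) (suc m) ≡ κ * z * (odd z ⋆ g) m
  ϑ-even-⋆ z g m = trans (⋆-dropˡ (ϑ 0ℚ (even z)) g m (ϑ-even-0 z))
    (trans (⋆-cong (ϑ-even z) (λ _ → refl) m) (⋆-scaleˡ (κ * z) (odd z) g m))

  ⋆-ϑ-even : ∀ z f m → (f ⋆ ϑ 0ℚ (even z)) (suc m) ≡ κ * z * (f ⋆ odd z) m
  ⋆-ϑ-even z f m = trans (⋆-comm f _ (suc m))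
    (trans (ϑ-even-⋆ z f m) (cong (κ * z *_) (⋆-comm (odd z) f m)))

  ϑ-odd-⋆ : ∀ z g m → (ϑ 1ℚ (odd z) ⋆ g) m ≡ z * (even z ⋆ g) m
  ϑ-odd-⋆ z g m = trans (⋆-cong (ϑ-odd z) (λ _ → refl) m) (⋆-scaleˡ z (even z) g m)

  ⋆-ϑ-odd : ∀ z f m → (f ⋆ ϑ 1ℚ (odd z)) m ≡ z * (f ⋆ even z) m
  ⋆-ϑ-odd z f m = trans (⋆-cong {f = f} (λ _ → refl) (ϑ-odd z) m) (⋆-scaleʳ z f (even z) m)

  -- For `κ = -1` these are the series of `cos x cos y - sin x sin y` and
  -- `sin x cos y + cos x sin y`. A product of two odd series starts with degree 2, hence the index
  -- `m` beside `suc m`.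
  evenSum oddSum : ℚ → ℚ → ℕ → ℚ
  evenSum x y zero    = (even x ⋆ even y) 0
  evenSum x y (suc m) = (even x ⋆ even y) (suc m) + κ * (odd x ⋆ odd y) m
  oddSum x y m = (odd x ⋆ even y) m + (even x ⋆ odd y) m

  weight-0-suc : ∀ m → weight 0ℚ (suc m) ≡ weight (1ℚ + 1ℚ) m
  weight-0-suc = weight-suc 0ℚ

  evenSum-suc : ∀ x y m →
    weight 0ℚ (suc m) * evenSum x y (suc m) ≡ κ * ((x + y) * oddSum x y m)
  evenSum-suc x y m = begin
    w * ((even x ⋆ even y) (suc m) + κ * (odd x ⋆ odd y) m)
      ≡⟨ solve 4 (λ w e κ o → w :* (e :+ κ :* o) := w :* e :+ κ :* (w :* o)) refl
           w ((even x ⋆ even y) (suc m)) κ ((odd x ⋆ odd y) m) ⟩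
    w * (even x ⋆ even y) (suc m) + κ * (w * (odd x ⋆ odd y) m)
      ≡⟨ cong₂ (λ p q → p + κ * q)
           (trans (leibniz 0ℚ 0ℚ (even x) (even y) (suc m))
             (cong₂ _+_ (ϑ-even-⋆ x (even y) m) (⋆-ϑ-even y (even x) m)))
           -- The offsets of two odd factors add up to `1ℚ + 1ℚ`, so their product at `m` has the
           -- same degree as the even product at `suc m`.
           (trans (cong (_* (odd x ⋆ odd y) m) (weight-0-suc m))
             (trans (leibniz 1ℚ 1ℚ (odd x) (odd y) m)
               (cong₂ _+_ (ϑ-odd-⋆ x (odd y) m) (⋆-ϑ-odd y (odd x) m)))) ⟩
    κ * x * oe + κ * y * eo + κ * (x * eo + y * oe)
      ≡⟨ solve 5 (λ κ x y oe eo → κ :* x :* oe :+ κ :* y :* eo :+ κ :* (x :* eo :+ y :* oe)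
           := κ :* ((x :+ y) :* (oe :+ eo))) refl κ x y oe eo ⟩
    κ * ((x + y) * oddSum x y m) ∎
    where
    open ≡-Reasoning
    w = weight 0ℚ (suc m)
    oe = (odd x ⋆ even y) m
    eo = (even x ⋆ odd y) m

  -- The derivatives of the even series stay unevaluated here: they contribute nothing at index 0
  -- and odd products from index 1 on, which matches the two cases of `evenSum`.
  oddSum-leibniz : ∀ x y m → weight 1ℚ m * oddSum x y m ≡
    (x * (even x ⋆ even y) m + (odd x ⋆ ϑ 0ℚ (even y)) m) +
    ((ϑ 0ℚ (even x) ⋆ odd y) m + y * (even x ⋆ even y) m)
  oddSum-leibniz x y m = trans (*-distribˡ-+ (weight 1ℚ m) _ _)
    (cong₂ _+_
      (trans (leibniz 1ℚ 0ℚ (odd x) (even y) m)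
        (cong (_+ (odd x ⋆ ϑ 0ℚ (even y)) m) (ϑ-odd-⋆ x (even y) m)))
      (trans (leibniz 0ℚ 1ℚ (even x) (odd y) m)
        (cong ((ϑ 0ℚ (even x) ⋆ odd y) m +_) (⋆-ϑ-odd y (even x) m))))

  oddSum-evenSum : ∀ x y m → weight 1ℚ m * oddSum x y m ≡ (x + y) * evenSum x y m
  oddSum-evenSum x y zero = trans (oddSum-leibniz x y zero)
    (trans
      (cong₂ (λ p q → (x * e + odd x 0 * p) + (q * odd y 0 + y * e))
        (ϑ-even-0 y) (ϑ-even-0 x))
      (solve 5 (λ x y e a b → (x :* e :+ a :* con 0ℚ) :+ (con 0ℚ :* b :+ y :* e)
        := (x :+ y) :* e) refl x y e (odd x 0) (odd y 0)))
    where e = (even x ⋆ even y) 0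
  oddSum-evenSum x y (suc m) = trans (oddSum-leibniz x y (suc m))
    (trans
      (cong₂ (λ p q → (x * e + p) + (q + y * e))
        (⋆-ϑ-even y (odd x) m) (ϑ-even-⋆ x (odd y) m))
      (solve 5 (λ x y e κ o → (x :* e :+ κ :* y :* o) :+ (κ :* x :* o :+ y :* e)
        := (x :+ y) :* (e :+ κ :* o)) refl x y e κ ((odd x ⋆ odd y) m)))
    where e = (even x ⋆ even y) (suc m)

  -- Both pairs solve the system `E' = κ (x + y) O`, `O' = (x + y) E` with constant term 1. The
  -- weights are positive and can be cancelled, so each coefficient is determined by the previous
  -- one: odd at `m` from even at `m`, even at `suc m` from odd at `m`.
  even-addition : ∀ x y m → evenSum x y m ≡ even (x + y) m
  odd-addition : ∀ x y m → oddSum x y m ≡ odd (x + y) m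
  even-addition x y zero rewrite even-0 = refl
  even-addition x y (suc m) = *-cancelˡ-≡ (weight 0ℚ (suc m))
    (subst (0ℚ <_) (sym (weight-0-suc m)) (0<weight m (positive⁻¹ (1ℚ + 1ℚ))))
    (begin
      weight 0ℚ (suc m) * evenSum x y (suc m) ≡⟨ evenSum-suc x y m ⟩
      κ * ((x + y) * oddSum x y m)
        ≡⟨ cong (λ q → κ * ((x + y) * q)) (odd-addition x y m) ⟩
      κ * ((x + y) * odd (x + y) m)           ≡⟨ sym (*-assoc κ (x + y) _) ⟩
      κ * (x + y) * odd (x + y) m             ≡⟨ sym (ϑ-even (x + y) m) ⟩
      weight 0ℚ (suc m) * even (x + y) (suc m) ∎)
    where open ≡-Reasoning
  odd-addition x y m = *-cancelˡ-≡ (weight 1ℚ m) (0<weight m (positive⁻¹ 1ℚ))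
    (trans (oddSum-evenSum x y m)
      (trans (cong ((x + y) *_) (even-addition x y m)) (sym (ϑ-odd (x + y) m))))

-- Dominated series and the error of truncated products.

p≤∣p∣ : ∀ p → p ≤ ∣ p ∣
p≤∣p∣ p with ≤-total 0ℚ p
... | inj₁ 0≤p = ≤-reflexive (sym (0≤p⇒∣p∣≡p 0≤p))
... | inj₂ p≤0 = ≤-trans p≤0 (0≤∣p∣ p)

partialSum : (ℕ → ℚ) → ℕ → ℚ
partialSum f zero    = 0ℚ
partialSum f (suc n) = partialSum f n + f n

partialSum-sucˡ : ∀ f n → partialSum f (suc n) ≡ f 0 + partialSum (f ∘ suc) n
partialSum-sucˡ f zero    = +-comm 0ℚ (f 0)
partialSum-sucˡ f (suc n) = trans (cong (_+ f (suc n)) (partialSum-sucˡ f n))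
  (+-assoc (f 0) _ _)

-- The triangle `i + j ≤ n` loses its row `i = 0`; what remains is a triangle of one size less for
-- the shifted `f`.
partialSum-⋆ : ∀ f g n →
  partialSum (f ⋆ g) (suc n) ≡ f 0 * partialSum g (suc n) + partialSum ((f ∘ suc) ⋆ g) n
partialSum-⋆ f g zero    =
  solve 2 (λ x y → con 0ℚ :+ x :* y := x :* (con 0ℚ :+ y) :+ con 0ℚ) refl (f 0) (g 0)
partialSum-⋆ f g (suc n) = trans
  (cong (_+ (f 0 * g (suc n) + ((f ∘ suc) ⋆ g) n)) (partialSum-⋆ f g n))
  (solve 5 (λ x s t y z → (x :* s :+ t) :+ (x :* y :+ z) := x :* (s :+ y) :+ (t :+ z))
    refl (f 0) (partialSum g (suc n)) (partialSum ((f ∘ suc) ⋆ g) n)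
    (g (suc n)) (((f ∘ suc) ⋆ g) n))

infix 4 _≼_

-- Domination by a majorant series; `F ≼ F` expresses that `F` is nonnegative.
_≼_ : (ℕ → ℚ) → (ℕ → ℚ) → Set
f ≼ F = ∀ k → ∣ f k ∣ ≤ F k

≼⇒0≤ : ∀ {f F} → f ≼ F → ∀ k → 0ℚ ≤ F k
≼⇒0≤ {f} f≼F k = ≤-trans (0≤∣p∣ (f k)) (f≼F k)

partialSum-tail : ∀ {f F} → f ≼ F → ∀ {m n} → m ℕ.≤ n →
  ∣ partialSum f n - partialSum f m ∣ ≤ partialSum F n - partialSum F m
partialSum-tail {f} {F} f≼F {m} {n} m≤n = subst
  (λ k → ∣ partialSum f k - partialSum f m ∣ ≤ partialSum F k - partialSum F m)
  (ℕ.m∸n+n≡m m≤n) (shifted (n ℕ.∸ m))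
  where
  shifted : ∀ j → ∣ partialSum f (j ℕ.+ m) - partialSum f m ∣
    ≤ partialSum F (j ℕ.+ m) - partialSum F m
  shifted zero    = subst₂ (λ p q → ∣ p ∣ ≤ q)
    (sym (+-inverseʳ (partialSum f m))) (sym (+-inverseʳ (partialSum F m))) ≤-refl
  shifted (suc j) = subst₂ (λ p q → ∣ p ∣ ≤ q)
    (swap (partialSum f k) (partialSum f m) (f k))
    (swap (partialSum F k) (partialSum F m) (F k))
    (≤-trans (∣p+q∣≤∣p∣+∣q∣ (partialSum f k - partialSum f m) (f k))
      (+-mono-≤ (shifted j) (f≼F k)))
    where
    k = j ℕ.+ m
    swap : ∀ s t u → s - t + u ≡ s + u - t
    swap = solve 3 (λ s t u → s :- t :+ u := s :+ u :- t) refl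

0≤q-p⇒p≤q : ∀ {p q} → 0ℚ ≤ q - p → p ≤ q
0≤q-p⇒p≤q {p} {q} h = subst (p ≤_)
  (solve 2 (λ p q → p :+ (q :- p) := q) refl p q) (p≤p+q p h)

partialSum-mono : ∀ {F} → F ≼ F → ∀ {m n} → m ℕ.≤ n → partialSum F m ≤ partialSum F n
partialSum-mono F≼F m≤n = 0≤q-p⇒p≤q (≤-trans (0≤∣p∣ _) (partialSum-tail F≼F m≤n))

⋆-mono : ∀ {f F g G} → f ≼ F → g ≼ G → f ⋆ g ≼ F ⋆ G
⋆-mono {f} {F} {g} {G} f≼F g≼G = go f≼F
  where
  term : ∀ a {A} m → ∣ a ∣ ≤ A → ∣ a * g m ∣ ≤ A * G m
  term a m a≤A = subst (_≤ _) (sym (∣p*q∣≡∣p∣*∣q∣ a (g m)))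
    (*-mono-≤-nonNeg (0≤∣p∣ a) (≼⇒0≤ g≼G m) a≤A (g≼G m))
  go : ∀ {f F} → f ≼ F → f ⋆ g ≼ F ⋆ G
  go {f} f≼F zero    = term (f 0) 0 (f≼F 0)
  go {f} f≼F (suc m) = ≤-trans (∣p+q∣≤∣p∣+∣q∣ (f 0 * g (suc m)) _)
    (+-mono-≤ (term (f 0) (suc m) (f≼F 0)) (go (f≼F ∘ suc) m))

-- The left-hand side collects the products f i * g j with i < n and n ≤ i + j.
rectangle-triangle : ∀ {f F g G} → f ≼ F → g ≼ G → ∀ {n q} → n ℕ.≤ q →
  ∣ partialSum f n * partialSum g q - partialSum (f ⋆ g) n ∣
    ≤ partialSum F n * partialSum G q - partialSum (F ⋆ G) n
rectangle-triangle {f} {F} {g} {G} f≼F g≼G {zero} {q} _ =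
  subst₂ (λ a b → ∣ a ∣ ≤ b) (vanish (partialSum g q)) (vanish (partialSum G q)) ≤-refl
  where
  vanish : ∀ s → 0ℚ ≡ 0ℚ * s - 0ℚ
  vanish = solve 1 (λ s → con 0ℚ := con 0ℚ :* s :- con 0ℚ) refl
rectangle-triangle {f} {F} {g} {G} f≼F g≼G {suc n} {q} n<q =
  subst₂ (λ a b → ∣ a ∣ ≤ b) (split f g) (split F G)
    (≤-trans (∣p+q∣≤∣p∣+∣q∣ (f 0 * (partialSum g q - partialSum g (suc n))) _)
      (+-mono-≤
        (subst (_≤ F 0 * (partialSum G q - partialSum G (suc n)))
          (sym (∣p*q∣≡∣p∣*∣q∣ (f 0) _))
          (*-mono-≤-nonNeg (0≤∣p∣ (f 0)) (≤-trans (0≤∣p∣ _) tail) (f≼F 0) tail))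
        (rectangle-triangle (f≼F ∘ suc) g≼G (ℕ.<⇒≤ n<q))))
  where
  tail = partialSum-tail g≼G n<q
  -- Row `i = 0` keeps the indices `j` from `suc n` up to `q`, exclusively; the other rows form the
  -- same region for the shifted `f`.
  split : ∀ f g → f 0 * (partialSum g q - partialSum g (suc n))
      + (partialSum (f ∘ suc) n * partialSum g q - partialSum ((f ∘ suc) ⋆ g) n)
    ≡ partialSum f (suc n) * partialSum g q - partialSum (f ⋆ g) (suc n)
  split f g = trans
    (solve 5 (λ x s t r u → x :* (s :- t) :+ (r :* s :- u)
      := (x :+ r) :* s :- (x :* t :+ u)) refl
      (f 0) (partialSum g q) (partialSum g (suc n))
      (partialSum (f ∘ suc) n) (partialSum ((f ∘ suc) ⋆ g) n))
    (sym (cong₂ (λ a b → a * partialSum g q - b) (partialSum-sucˡ f n) (partialSum-⋆ f g n)))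

-- The rectangle `i < n`, `j < q` lies inside the triangle `i + j < n + q`, and all terms are
-- nonnegative.
rectangle≤triangle : ∀ {F G} → F ≼ F → G ≼ G → ∀ n q →
  partialSum F n * partialSum G q ≤ partialSum (F ⋆ G) (n ℕ.+ q)
rectangle≤triangle {F} {G} F≼F G≼G zero q = subst (_≤ partialSum (F ⋆ G) q)
  (sym (*-zeroˡ (partialSum G q))) (partialSum-mono (⋆-mono F≼F G≼G) {0} {q} ℕ.z≤n)
rectangle≤triangle {F} {G} F≼F G≼G (suc n) q = subst₂ _≤_
  (sym (trans (cong (_* partialSum G q) (partialSum-sucˡ F n))
    (*-distribʳ-+ (partialSum G q) (F 0) (partialSum (F ∘ suc) n))))
  (sym (partialSum-⋆ F G (n ℕ.+ q)))
  (+-mono-≤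
    (*-monoˡ-≤-nonNeg (F 0) {{nonNegative (≼⇒0≤ F≼F 0)}}
      (partialSum-mono G≼G (ℕ.m≤n⇒m≤1+n (ℕ.m≤n+m q n))))
    (rectangle≤triangle (F≼F ∘ suc) G≼G n q))

-- The products missing from the Cauchy product satisfy `n ≤ i + j < n + n`, so the section of
-- `F ⋆ G` between these indices dominates them, and `V` dominates that section.
partialSum-product : ∀ {f F g G V} → f ≼ F → F ≼ F → g ≼ G → G ≼ G → F ⋆ G ≼ V → ∀ n →
  ∣ partialSum f n * partialSum g n - partialSum (f ⋆ g) n ∣
    ≤ partialSum V (n ℕ.+ n) - partialSum V n
partialSum-product {F = F} {G = G} f≼F F≼F g≼G G≼G FG≼V n = ≤-trans
  (rectangle-triangle f≼F g≼G (ℕ.≤-refl {n}))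
  (≤-trans (+-monoˡ-≤ (- partialSum (F ⋆ G) n) (rectangle≤triangle F≼F G≼G n n))
    (≤-trans (p≤∣p∣ _) (partialSum-tail FG≼V (ℕ.m≤n+m n n))))

-- The cosine series and its hyperbolic majorant.

weight-0 : ∀ k → weight 0ℚ k ≡ fromℕ (2 ℕ.* k)
weight-0 k = trans (+-identityʳ (2ℚ * fromℕ k)) (sym (fromℕ-* 2 k))

-- `growth k` is `(2k+2)(2k+1)`, one factor for each of the two differentiations leading from index
-- `suc k` back to `k`.
fromℕ-growth : ∀ k → fromℕ (growth k) ≡ weight 0ℚ (suc k) * weight 1ℚ k
fromℕ-growth k = trans (fromℕ-* (suc (suc (2 ℕ.* k))) (suc (2 ℕ.* k))) (cong₂ _*_
  (trans (cong fromℕ (sym (2·suc k))) (sym (weight-0 (suc k))))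
  (trans (fromℕ-suc (2 ℕ.* k))
    (trans (+-comm 1ℚ (fromℕ (2 ℕ.* k))) (cong (_+ 1ℚ) (fromℕ-* 2 k)))))

cosCoeff-suc : ∀ k → cosCoeff (suc k) * fromℕ (growth k) ≡ - cosCoeff k
cosCoeff-suc k = /-step (ℤ.-1ℤ ℤ.^ k) ((2 ℕ.* k) !) ((2 ℕ.* suc k) !) (growth k)
  {{(2 ℕ.* k) ℕ.!≢0}} {{(2 ℕ.* suc k) ℕ.!≢0}} (!-step k)

-- The sine coefficients are defined as the derivative of the cosine dictates; the other
-- differential equation is then the recursion of `cosCoeff`.
module Cos = EvenOdd cosCoeff (λ k → - (weight 0ℚ (suc k) * cosCoeff (suc k))) (- 1ℚ) refl
  (λ k → solve 1 (λ p → p := con (- 1ℚ) :* (:- p)) refl (weight 0ℚ (suc k) * cosCoeff (suc k)))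
  (λ k → trans
    (solve 3 (λ w v c → v :* (:- (w :* c)) := :- (c :* (w :* v))) refl
      (weight 0ℚ (suc k)) (weight 1ℚ k) (cosCoeff (suc k)))
    (trans (cong (λ q → - (cosCoeff (suc k) * q)) (sym (fromℕ-growth k)))
      (trans (cong -_ (cosCoeff-suc k)) (solve 1 (λ c → :- (:- c) := c) refl (cosCoeff k)))))

-- `Cosh.even B` is `majorant B` by definition, so the addition formula becomes available for
-- majorants.
module Cosh = EvenOdd (∣_∣ ∘ cosCoeff) (λ k → weight 0ℚ (suc k) * ∣ cosCoeff (suc k) ∣) 1ℚ refl
  (λ k → sym (*-identityˡ _))
  (λ k → trans
    (solve 3 (λ w v c → v :* (w :* c) := c :* (w :* v)) refl
      (weight 0ℚ (suc k)) (weight 1ℚ k) ∣ cosCoeff (suc k) ∣)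
    (trans (cong (∣ cosCoeff (suc k) ∣ *_) (sym (fromℕ-growth k))) (cosCoeff-step k)))

0≤⇒≼ : ∀ {F} → (∀ k → 0ℚ ≤ F k) → F ≼ F
0≤⇒≼ 0≤F k = ≤-reflexive (0≤p⇒∣p∣≡p (0≤F k))

-- Coefficientwise, `cosh B cosh B ≤ cosh B cosh B + sinh B sinh B = cosh (B + B)`.
majorant-⋆ : ∀ B → 0ℚ ≤ B → majorant B ⋆ majorant B ≼ majorant (B + B)
majorant-⋆ B 0≤B k = subst (_≤ majorant (B + B) k) (sym (0≤p⇒∣p∣≡p (0≤⋆ even≼ k)))
  (subst ((majorant B ⋆ majorant B) k ≤_) (Cosh.even-addition B B k) (bound k))
  where
  even≼ : majorant B ≼ majorant B
  even≼ = 0≤⇒≼ λ k → majorant-0≤ k 0≤B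
  odd≼ : Cosh.odd B ≼ Cosh.odd B
  odd≼ = 0≤⇒≼ λ k → *-0≤
    (*-0≤ (subst (0ℚ ≤_) (sym (weight-0 (suc k))) (fromℕ-0≤ (2 ℕ.* suc k))) (0≤∣p∣ (cosCoeff (suc k))))
    (*-0≤ 0≤B (^ℚ-0≤ (2 ℕ.* k) 0≤B))
  0≤⋆ : ∀ {f} → f ≼ f → ∀ k → 0ℚ ≤ (f ⋆ f) k
  0≤⋆ f≼f = ≼⇒0≤ (⋆-mono f≼f f≼f)
  bound : ∀ k → (majorant B ⋆ majorant B) k ≤ Cosh.evenSum B B k
  bound zero    = ≤-refl
  bound (suc k) = p≤p+q _ (*-0≤ (<⇒≤ (positive⁻¹ 1ℚ)) (0≤⋆ odd≼ k))

-- From `N` on every term is at most half of its predecessor, as in a geometric series. The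
-- induction carries `u k + u k` as a reserve for the terms still to come.
majorant-sum : ∀ {B} N → 0ℚ ≤ B → B ≤ fromℕ N → ∀ {n} → N ℕ.≤ n →
  partialSum (majorant B) n - partialSum (majorant B) N ≤ majorant B N + majorant B N
majorant-sum {B} N 0≤B B≤N {n} N≤n = ≤-trans
  (p≤p+q _ (+-0≤ (majorant-0≤ n 0≤B) (majorant-0≤ n 0≤B)))
  (subst (λ k → partialSum u k - partialSum u N + (u k + u k) ≤ u N + u N)
    (ℕ.m∸n+n≡m N≤n) (shifted (n ℕ.∸ N)))
  where
  u = majorant B
  shifted : ∀ j → partialSum u (j ℕ.+ N) - partialSum u N + (u (j ℕ.+ N) + u (j ℕ.+ N))
    ≤ u N + u N
  shifted zero    = ≤-reflexive
    (solve 2 (λ s v → s :- s :+ (v :+ v) := v :+ v) refl (partialSum u N) (u N))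
  shifted (suc j) = ≤-trans
    (subst (partialSum u (suc k) - partialSum u N + (u (suc k) + u (suc k)) ≤_)
      (solve 3 (λ s t v → s :+ v :- t :+ v := s :- t :+ (v :+ v)) refl
        (partialSum u k) (partialSum u N) (u k))
      (+-monoʳ-≤ (partialSum u (suc k) - partialSum u N)
        (majorant-step k 0≤B (≤-trans B≤N (fromℕ-mono (ℕ.m≤n+m N j))))))
    (shifted j)
    where k = j ℕ.+ N

cos-≼ : ∀ {B z} → 0ℚ ≤ B → ∣ z ∣ ≤ B → Cos.even z ≼ majorant B
cos-≼ {B} {z} 0≤B z≤B k = subst (_≤ majorant B k)
  (sym (∣p*q∣≡∣p∣*∣q∣ (cosCoeff k) (z ^ℚ (2 ℕ.* k))))
  (*-monoˡ-≤-nonNeg ∣ cosCoeff k ∣ {{nonNegative (0≤∣p∣ (cosCoeff k))}}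
    (^ℚ-bound (2 ℕ.* k) 0≤B z≤B))

cosSumℚ≡ : ∀ n z → cosSumℚ n z ≡ partialSum (Cos.even z) n
cosSumℚ≡ zero    z = refl
cosSumℚ≡ (suc n) z = cong (_+ Cos.even z n) (cosSumℚ≡ n z)

-- `N` depends on `B` and `ε` alone. This is essential because in the diagonal sequence of `cos` the
-- argument varies together with the truncation.
cos-product-uniform : ∀ B ε → 0ℚ ≤ B → 0ℚ < ε → ∃[ N ] ∀ x y → ∣ x ∣ ≤ B → ∣ y ∣ ≤ B →
  ∀ n → N ℕ.≤ n →
  ∣ cosSumℚ n x * cosSumℚ n y - partialSum (Cos.even x ⋆ Cos.even y) n ∣ ≤ ε
cos-product-uniform B ε 0≤B 0<ε = N , λ x y x≤B y≤B n N≤n →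
  subst₂ (λ p q → ∣ p * q - partialSum (Cos.even x ⋆ Cos.even y) n ∣ ≤ ε)
    (sym (cosSumℚ≡ n x)) (sym (cosSumℚ≡ n y))
    (≤-trans
      (partialSum-product (cos-≼ 0≤B x≤B) M≼M (cos-≼ 0≤B y≤B) M≼M (majorant-⋆ B 0≤B) n)
      (tail n N≤n))
  where
  V = majorant (B + B)
  0≤2B = +-0≤ 0≤B 0≤B
  found = majorant-small (B + B) (½ * ε) 0≤2B (0<½* 0<ε)
  N = proj₁ found
  M≼M : majorant B ≼ majorant B
  M≼M = 0≤⇒≼ λ k → majorant-0≤ k 0≤B
  V≼V : V ≼ V
  V≼V = 0≤⇒≼ λ k → majorant-0≤ k 0≤2B
  small : V N ≤ ½ * ε
  small = proj₂ (proj₂ found)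
  tail : ∀ n → N ℕ.≤ n → partialSum V (n ℕ.+ n) - partialSum V n ≤ ε
  tail n N≤n = ≤-trans
    -- The section from `n` to `n + n` is enlarged to start at `N`, where `majorant-sum` applies.
    (+-monoʳ-≤ (partialSum V (n ℕ.+ n)) (neg-antimono-≤ (partialSum-mono V≼V N≤n)))
    (≤-trans
      (majorant-sum N 0≤2B (proj₁ (proj₂ found)) (ℕ.≤-trans N≤n (ℕ.m≤n+m n n)))
      (subst (V N + V N ≤_) (½+½ ε) (+-mono-≤ small small)))

-- The product formula for the real cosine.

^ℚ-neg : ∀ z k → (- z) ^ℚ (2 ℕ.* k) ≡ z ^ℚ (2 ℕ.* k)
^ℚ-neg z zero    = refl
^ℚ-neg z (suc k) = begin
  (- z) ^ℚ (2 ℕ.* suc k)               ≡⟨ cong ((- z) ^ℚ_) (2·suc k) ⟩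
  (- z) * ((- z) * (- z) ^ℚ (2 ℕ.* k)) ≡⟨ cong (λ q → (- z) * ((- z) * q)) (^ℚ-neg z k) ⟩
  (- z) * ((- z) * z ^ℚ (2 ℕ.* k))
    ≡⟨ solve 2 (λ z p → (:- z) :* ((:- z) :* p) := z :* (z :* p)) refl z (z ^ℚ (2 ℕ.* k)) ⟩
  z * (z * z ^ℚ (2 ℕ.* k))             ≡⟨ cong (z ^ℚ_) (sym (2·suc k)) ⟩
  z ^ℚ (2 ℕ.* suc k) ∎
  where open ≡-Reasoning

cos-neg : ∀ z k → Cos.even (- z) k ≡ Cos.even z k
cos-neg z k = cong (cosCoeff k *_) (^ℚ-neg z k)

sin-neg : ∀ z k → Cos.odd (- z) k ≡ - 1ℚ * Cos.odd z k
sin-neg z k = trans (cong (λ q → c * (- z * q)) (^ℚ-neg z k))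
  (solve 3 (λ c z p → c :* ((:- z) :* p) := con (- 1ℚ) :* (c :* (z :* p))) refl
    c z (z ^ℚ (2 ℕ.* k)))
  where c = - (weight 0ℚ (suc k) * cosCoeff (suc k))

-- In the sum of the addition formulas for `y` and `- y` the sine products cancel, since sine is
-- odd.
cos-⋆ : ∀ x y k → Cos.even (x + y) k + Cos.even (x - y) k
  ≡ (Cos.even x ⋆ Cos.even y) k + (Cos.even x ⋆ Cos.even y) k
cos-⋆ x y k = trans
  (sym (cong₂ _+_ (Cos.even-addition x y k) (Cos.even-addition x (- y) k)))
  (doubled k)
  where
  E = Cos.even x ⋆ Cos.even y
  E-neg : ∀ k → (Cos.even x ⋆ Cos.even (- y)) k ≡ E k
  E-neg = ⋆-cong {f = Cos.even x} (λ _ → refl) (cos-neg y)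
  O = Cos.odd x ⋆ Cos.odd y
  O-neg : ∀ k → (Cos.odd x ⋆ Cos.odd (- y)) k ≡ - 1ℚ * O k
  O-neg k = trans (⋆-cong {f = Cos.odd x} (λ _ → refl) (sin-neg y) k)
    (⋆-scaleʳ (- 1ℚ) (Cos.odd x) (Cos.odd y) k)
  doubled : ∀ k → Cos.evenSum x y k + Cos.evenSum x (- y) k ≡ E k + E k
  doubled zero    = cong (E 0 +_) (E-neg 0)
  doubled (suc k) = trans
    (cong₂ (λ p q → E (suc k) + - 1ℚ * O k + (p + - 1ℚ * q)) (E-neg (suc k)) (O-neg k))
    (solve 2 (λ e o → e :+ con (- 1ℚ) :* o :+ (e :+ con (- 1ℚ) :* (con (- 1ℚ) :* o)) := e :+ e)
      refl (E (suc k)) (O k))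

-- Exact at every truncation; an error arises only when the Cauchy product is replaced by the
-- product of the partial sums.
cosSumℚ-sum : ∀ x y n → cosSumℚ n (x + y) + cosSumℚ n (x - y)
  ≡ partialSum (Cos.even x ⋆ Cos.even y) n + partialSum (Cos.even x ⋆ Cos.even y) n
cosSumℚ-sum x y zero    = refl
cosSumℚ-sum x y (suc n) = trans
  (interchange (cosSumℚ n (x + y)) (Cos.even (x + y) n) (cosSumℚ n (x - y)) (Cos.even (x - y) n))
  (trans (cong₂ _+_ (cosSumℚ-sum x y n) (cos-⋆ x y n)) (sym (interchange P c P c)))
  where
  P = partialSum (Cos.even x ⋆ Cos.even y) n
  c = (Cos.even x ⋆ Cos.even y) n
  interchange : ∀ a b c d → (a + b) + (c + d) ≡ (a + c) + (b + d)
  interchange = solve 4 (λ a b c d → (a :+ b) :+ (c :+ d) := (a :+ c) :+ (b :+ d)) refl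

cos-product : ∀ x y → cos (x +ℝ y) +ℝ cos (x +ℝ (-ℝ y)) ≈ℝ fromℚ 2ℚ *ℝ (cos x *ℝ cos y)
cos-product x y = mk≈ λ ε 0<ε →
  -- The difference of the two sides is `- gap + - gap`, at most `½ * ε` with this `δ`; the other
  -- half of `ε` makes the inequality strict.
  let δ = ½ * (½ * ε)
      (N , near) = cos-product-uniform B δ (+-0≤ 0≤Bx 0≤By) (0<½* (0<½* 0<ε))
  in N , λ n N≤n →
    let a = seq x n
        b = seq y n
        gap = cosSumℚ n a * cosSumℚ n b - partialSum (Cos.even a ⋆ Cos.even b) n
        gap≤δ = subst (_≤ δ) (sym (∣-p∣≡∣p∣ gap)) (near a b (x≤B n) (y≤B n) n N≤n)
    in ≤-<-trans
      (subst (λ q → ∣ q ∣ ≤ ½ * ε)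
        (trans
          (sym (difference {cosSumℚ n (a + b) + cosSumℚ n (a - b)}
            {partialSum (Cos.even a ⋆ Cos.even b) n} {cosSumℚ n a * cosSumℚ n b}
            (cosSumℚ-sum a b n)))
          (sym (cong₂ (λ p q → p - 2ℚ * q)
            (cong₂ _+_ (seq-cosSum n (x +ℝ y) n) (seq-cosSum n (x +ℝ (-ℝ y)) n))
            (cong₂ _*_ (seq-cosSum n x n) (seq-cosSum n y n)))))
        (≤-trans (∣p+q∣≤∣p∣+∣q∣ (- gap) (- gap))
          (subst (∣ - gap ∣ + ∣ - gap ∣ ≤_) (½+½ (½ * ε)) (+-mono-≤ gap≤δ gap≤δ))))
      (subst₂ _<_ (+-identityʳ (½ * ε)) (½+½ ε) (+-monoʳ-< (½ * ε) (0<½* 0<ε)))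
  where
  Bx = bounded x
  By = bounded y
  B = proj₁ Bx + proj₁ By
  0≤Bx = <⇒≤ (proj₁ (proj₂ Bx))
  0≤By = <⇒≤ (proj₁ (proj₂ By))
  x≤B : ∀ n → ∣ seq x n ∣ ≤ B
  x≤B n = ≤-trans (proj₂ (proj₂ Bx) n) (p≤p+q (proj₁ Bx) 0≤By)
  y≤B : ∀ n → ∣ seq y n ∣ ≤ B
  y≤B n = ≤-trans (proj₂ (proj₂ By) n)
    (subst (proj₁ By ≤_) (+-comm (proj₁ By) (proj₁ Bx)) (p≤p+q (proj₁ By) 0≤Bx))
  difference : ∀ {a s c} → a ≡ s + s → a - 2ℚ * c ≡ - (c - s) + - (c - s)
  difference {s = s} {c = c} refl =
    solve 2 (λ c s → s :+ s :- con 2ℚ :* c := (:- (c :- s)) :+ (:- (c :- s))) refl c s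

-- Setoid laws of the reals and the semiring of complex numbers.

pointwise : ∀ {x y} → (∀ n → seq x n ≡ seq y n) → x ≈ℝ y
pointwise {x} {y} x≡y = mk≈ λ ε 0<ε → 0 , λ n _ →
  subst (λ q → ∣ seq x n - q ∣ < ε) (x≡y n) (dist-refl (seq x n) 0<ε)

≈ℝ-refl : ∀ {x} → x ≈ℝ x
≈ℝ-refl = pointwise λ _ → refl

≈ℝ-sym : ∀ {x y} → x ≈ℝ y → y ≈ℝ x
≈ℝ-sym {x} {y} (mk≈ p) = mk≈ λ ε 0<ε → let (N , h) = p ε 0<ε in
  N , λ n N≤n → subst (_< ε) (dist-sym (seq x n) (seq y n)) (h n N≤n)

≈ℝ-trans : ∀ {x y z} → x ≈ℝ y → y ≈ℝ z → x ≈ℝ z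
≈ℝ-trans {x} {y} {z} (mk≈ p) (mk≈ q) = mk≈ λ ε 0<ε →
  let (M , hM) = p (½ * ε) (0<½* 0<ε)
      (N , hN) = q (½ * ε) (0<½* 0<ε)
  in M ℕ.⊔ N , λ n n≥ → ≤-<-trans (dist-triangle (seq x n) (seq y n) (seq z n))
    (subst (∣ seq x n - seq y n ∣ + ∣ seq y n - seq z n ∣ <_) (½+½ ε)
      (+-mono-< (hM n (ℕ.m⊔n≤o⇒m≤o M N n≥)) (hN n (ℕ.m⊔n≤o⇒n≤o M N n≥))))

-ℝ-cong : ∀ {x y} → x ≈ℝ y → -ℝ x ≈ℝ -ℝ y
-ℝ-cong {x} {y} (mk≈ p) = mk≈ λ ε 0<ε → let (N , h) = p ε 0<ε in
  N , λ n N≤n → subst (_< ε)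
    (trans (sym (∣-p∣≡∣p∣ (seq x n - seq y n)))
      (cong ∣_∣ (solve 2 (λ a b → :- (a :- b) := (:- a) :- (:- b)) refl (seq x n) (seq y n))))
    (h n N≤n)

*ℝ-inverse⁺ : ∀ x 0<x → x *ℝ inverse⁺ x 0<x ≈ℝ 1ℝ
*ℝ-inverse⁺ x (mk< γ 0<γ (N , above)) = mk≈ λ ε 0<ε → N , λ n N≤n →
  subst (λ q → ∣ q - 1ℚ ∣ < ε)
    (sym (invℚ-inverse (seq x n)
      (<-≤-trans 0<γ (subst (_≤ seq x n) (+-identityˡ γ) (above n N≤n)))))
    (dist-refl 1ℚ 0<ε)

pointwiseℂ : ∀ {z w} → (∀ n → seq (re z) n ≡ seq (re w) n) →
  (∀ n → seq (im z) n ≡ seq (im w) n) → z ≈ℂ w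
pointwiseℂ p q = mk≈ℂ (pointwise p) (pointwise q)

≈ℂ-isEquivalence : IsEquivalence _≈ℂ_
≈ℂ-isEquivalence = record
  { refl  = mk≈ℂ ≈ℝ-refl ≈ℝ-refl
  ; sym   = λ (mk≈ℂ p q) → mk≈ℂ (≈ℝ-sym p) (≈ℝ-sym q)
  ; trans = λ (mk≈ℂ p q) (mk≈ℂ r s) → mk≈ℂ (≈ℝ-trans p r) (≈ℝ-trans q s)
  }

1ℂ : ℂ
1ℂ = ofℚ 1ℚ

+ℂ-isCommutativeMonoid : IsCommutativeMonoid _≈ℂ_ _+ℂ_ 0ℂ
+ℂ-isCommutativeMonoid = isCommutativeMonoidˡ record
  { isSemigroup = record
    { isMagma = record
      { isEquivalence = ≈ℂ-isEquivalence
      ; ∙-cong = λ (mk≈ℂ p q) (mk≈ℂ r s) → mk≈ℂ (+ℝ-cong p r) (+ℝ-cong q s)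
      }
    ; assoc = λ (a +i b) (c +i d) (e +i f) → pointwiseℂ
        (λ n → +-assoc (seq a n) (seq c n) (seq e n))
        (λ n → +-assoc (seq b n) (seq d n) (seq f n))
    }
  ; identityˡ = λ (a +i b) → pointwiseℂ
      (λ n → +-identityˡ (seq a n)) (λ n → +-identityˡ (seq b n))
  ; comm = λ (a +i b) (c +i d) → pointwiseℂ
      (λ n → +-comm (seq a n) (seq c n)) (λ n → +-comm (seq b n) (seq d n))
  }

*ℂ-isCommutativeMonoid : IsCommutativeMonoid _≈ℂ_ _*ℂ_ 1ℂ
*ℂ-isCommutativeMonoid = isCommutativeMonoidˡ record
  { isSemigroup = record
    { isMagma = record
      { isEquivalence = ≈ℂ-isEquivalence
      ; ∙-cong = λ (mk≈ℂ p q) (mk≈ℂ r s) → mk≈ℂ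
          (+ℝ-cong (*ℝ-cong p r) (-ℝ-cong (*ℝ-cong q s)))
          (+ℝ-cong (*ℝ-cong p s) (*ℝ-cong q r))
      }
    ; assoc = λ (a +i b) (c +i d) (e +i f) → pointwiseℂ
        (λ n → solve 6 (λ a b c d e f →
            (a :* c :+ :- (b :* d)) :* e :+ :- ((a :* d :+ b :* c) :* f) :=
            a :* (c :* e :+ :- (d :* f)) :+ :- (b :* (c :* f :+ d :* e)))
          refl (seq a n) (seq b n) (seq c n) (seq d n) (seq e n) (seq f n))
        (λ n → solve 6 (λ a b c d e f →
            (a :* c :+ :- (b :* d)) :* f :+ (a :* d :+ b :* c) :* e :=
            a :* (c :* f :+ d :* e) :+ b :* (c :* e :+ :- (d :* f)))
          refl (seq a n) (seq b n) (seq c n) (seq d n) (seq e n) (seq f n))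
    }
  ; identityˡ = λ (a +i b) → pointwiseℂ
      (λ n → solve 2 (λ a b → con 1ℚ :* a :+ :- (con 0ℚ :* b) := a) refl (seq a n) (seq b n))
      (λ n → solve 2 (λ a b → con 1ℚ :* b :+ con 0ℚ :* a := b) refl (seq a n) (seq b n))
  ; comm = λ (a +i b) (c +i d) → pointwiseℂ
      (λ n → cong₂ (λ p q → p + - q) (*-comm (seq a n) (seq c n)) (*-comm (seq b n) (seq d n)))
      (λ n → solve 4 (λ a b c d → a :* d :+ b :* c := c :* b :+ d :* a) refl
        (seq a n) (seq b n) (seq c n) (seq d n))
  }

-- A semiring suffices for the algebra below, since `g(t) = -w²` enters as a vanishing sum.
ℂ-commutativeSemiring : CommutativeSemiring _ _
ℂ-commutativeSemiring = record
  { isCommutativeSemiring = isCommutativeSemiringˡ record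
    { +-isCommutativeMonoid = +ℂ-isCommutativeMonoid
    ; *-isCommutativeMonoid = *ℂ-isCommutativeMonoid
    ; distribʳ = λ (a +i b) (c +i d) (e +i f) → pointwiseℂ
        (λ n → solve 6 (λ a b c d e f →
            (c :+ e) :* a :+ :- ((d :+ f) :* b) :=
            (c :* a :+ :- (d :* b)) :+ (e :* a :+ :- (f :* b)))
          refl (seq a n) (seq b n) (seq c n) (seq d n) (seq e n) (seq f n))
        (λ n → solve 6 (λ a b c d e f →
            (c :+ e) :* b :+ (d :+ f) :* a :=
            (c :* b :+ d :* a) :+ (e :* b :+ f :* a))
          refl (seq a n) (seq b n) (seq c n) (seq d n) (seq e n) (seq f n))
    ; zeroˡ = λ (a +i b) → pointwiseℂ
        (λ n → solve 2 (λ a b → con 0ℚ :* a :+ :- (con 0ℚ :* b) := con 0ℚ) refl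
          (seq a n) (seq b n))
        (λ n → solve 2 (λ a b → con 0ℚ :* b :+ con 0ℚ :* a := con 0ℚ) refl
          (seq a n) (seq b n))
    }
  }

module ℂₛ = CommutativeSemiring ℂ-commutativeSemiring
open SetoidReasoning ℂₛ.setoid
import Algebra.Solver.Ring.NaturalCoefficients.Default ℂ-commutativeSemiring as ℂSolver
open ℂSolver using () renaming (solve to ℂ-solve; _:+_ to _⊕_; _:*_ to _⊗_; _:=_ to _⊜_)

-- Embeddings into the complex numbers, and division.

ofℝ-cong : ∀ {x y} → x ≈ℝ y → ofℝ x ≈ℂ ofℝ y
ofℝ-cong p = mk≈ℂ p ≈ℝ-refl

ofℚ-cong : ∀ {a b} → a ≡ b → ofℚ a ≈ℂ ofℚ b
ofℚ-cong refl = ℂₛ.refl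

ofℝ-+ : ∀ x y → ofℝ (x +ℝ y) ≈ℂ ofℝ x +ℂ ofℝ y
ofℝ-+ x y = pointwiseℂ (λ _ → refl) (λ _ → refl)

ofℝ-* : ∀ x y → ofℝ (x *ℝ y) ≈ℂ ofℝ x *ℂ ofℝ y
ofℝ-* x y = pointwiseℂ
  (λ n → solve 2 (λ a b → a :* b := a :* b :+ :- (con 0ℚ :* con 0ℚ)) refl (seq x n) (seq y n))
  (λ n → solve 2 (λ a b → con 0ℚ := a :* con 0ℚ :+ con 0ℚ :* b) refl (seq x n) (seq y n))

ofℚ-+ : ∀ a b → ofℚ (a + b) ≈ℂ ofℚ a +ℂ ofℚ b
ofℚ-+ a b = ℂₛ.trans (ofℝ-cong (pointwise λ _ → refl)) (ofℝ-+ (fromℚ a) (fromℚ b))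

ofℚ-* : ∀ a b → ofℚ (a * b) ≈ℂ ofℚ a *ℂ ofℚ b
ofℚ-* a b = ℂₛ.trans (ofℝ-cong (pointwise λ _ → refl)) (ofℝ-* (fromℚ a) (fromℚ b))

inverseℂ-*ℂ : ∀ z z≠0 → inverseℂ z z≠0 *ℂ z ≈ℂ 1ℂ
inverseℂ-*ℂ z@(a +i b) z≠0 = mk≈ℂ
  (≈ℝ-trans
    (pointwise λ n → solve 3 (λ a b r → a :* r :* a :+ :- ((:- (b :* r)) :* b)
      := (a :* a :+ b :* b) :* r) refl (seq a n) (seq b n) (seq r n))
    (*ℝ-inverse⁺ (normSq z) z≠0))
  (pointwise λ n → solve 3 (λ a b r → a :* r :* b :+ (:- (b :* r)) :* a := con 0ℚ) refl
    (seq a n) (seq b n) (seq r n))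
  where r = inverse⁺ (normSq z) z≠0

/ℂ-*ℂ : ∀ z w w≠0 → (z /ℂ w ⟨ w≠0 ⟩) *ℂ w ≈ℂ z
/ℂ-*ℂ z w w≠0 = begin
  z *ℂ inverseℂ w w≠0 *ℂ w   ≈⟨ ℂₛ.*-assoc z _ w ⟩
  z *ℂ (inverseℂ w w≠0 *ℂ w) ≈⟨ ℂₛ.*-congˡ (inverseℂ-*ℂ w w≠0) ⟩
  z *ℂ 1ℂ                    ≈⟨ ℂₛ.*-identityʳ z ⟩
  z                          ∎

-- Subtraction-free form of `(i z)² = -z²`; with `z` the root of `g(t)` it yields `g(t) + w² = 0`.
𝕚-square : ∀ z → z *ℂ z +ℂ (𝕚 *ℂ z) *ℂ (𝕚 *ℂ z) ≈ℂ 0ℂ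
𝕚-square (a +i b) = pointwiseℂ
  (λ n → solve 2 (λ a b →
      (a :* a :+ :- (b :* b)) :+ (iR a b :* iR a b :+ :- (iI a b :* iI a b)) := con 0ℚ)
    refl (seq a n) (seq b n))
  (λ n → solve 2 (λ a b →
      (a :* b :+ b :* a) :+ (iR a b :* iI a b :+ iI a b :* iR a b) := con 0ℚ)
    refl (seq a n) (seq b n))
  where
  iR iI : ∀ {n} (a b : +-*-Solver.Polynomial n) → +-*-Solver.Polynomial n
  iR a b = con 0ℚ :* a :+ :- (con 1ℚ :* b)
  iI a b = con 0ℚ :* b :+ con 1ℚ :* a

-- Evaluation of polynomials as a ring homomorphism.

eval-≈[] : ∀ p t → p ≈ₚ [] → eval p t ≈ℂ 0ℂ
eval-≈[] []      t p≈0 = ℂₛ.refl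
eval-≈[] (a ∷ p) t p≈0 = begin
  ofℚ a +ℂ t *ℂ eval p t
    ≈⟨ ℂₛ.+-cong (ofℚ-cong (p≈0 0)) (ℂₛ.*-congˡ (eval-≈[] p t (p≈0 ∘ suc))) ⟩
  0ℂ +ℂ t *ℂ 0ℂ ≈⟨ ℂₛ.+-identityˡ _ ⟩
  t *ℂ 0ℂ       ≈⟨ ℂₛ.zeroʳ t ⟩
  0ℂ            ∎

-- Serves to evaluate `d≈αp₁`, where the two lists may differ by trailing zeros.
eval-cong : ∀ p q t → p ≈ₚ q → eval p t ≈ℂ eval q t
eval-cong []      q       t p≈q = ℂₛ.sym (eval-≈[] q t (sym ∘ p≈q))
eval-cong (a ∷ p) []      t p≈q = eval-≈[] (a ∷ p) t p≈q
eval-cong (a ∷ p) (b ∷ q) t p≈q =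
  ℂₛ.+-cong (ofℚ-cong (p≈q 0)) (ℂₛ.*-congˡ (eval-cong p q t (p≈q ∘ suc)))

eval-+ₚ : ∀ p q t → eval (p +ₚ q) t ≈ℂ eval p t +ℂ eval q t
eval-+ₚ []      q       t = ℂₛ.sym (ℂₛ.+-identityˡ _)
eval-+ₚ (a ∷ p) []      t = ℂₛ.sym (ℂₛ.+-identityʳ _)
eval-+ₚ (a ∷ p) (b ∷ q) t = ℂₛ.trans
  (ℂₛ.+-cong (ofℚ-+ a b) (ℂₛ.*-congˡ (eval-+ₚ p q t)))
  (ℂ-solve 5 (λ a b t P Q → a ⊕ b ⊕ t ⊗ (P ⊕ Q) ⊜ a ⊕ t ⊗ P ⊕ (b ⊕ t ⊗ Q)) ℂₛ.refl
    (ofℚ a) (ofℚ b) t (eval p t) (eval q t))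

eval-·ₚ : ∀ a p t → eval (a ·ₚ p) t ≈ℂ ofℚ a *ℂ eval p t
eval-·ₚ a []      t = ℂₛ.sym (ℂₛ.zeroʳ (ofℚ a))
eval-·ₚ a (b ∷ p) t = ℂₛ.trans
  (ℂₛ.+-cong (ofℚ-* a b) (ℂₛ.*-congˡ (eval-·ₚ a p t)))
  (ℂ-solve 4 (λ a b t P → a ⊗ b ⊕ t ⊗ (a ⊗ P) ⊜ a ⊗ (b ⊕ t ⊗ P)) ℂₛ.refl
    (ofℚ a) (ofℚ b) t (eval p t))

eval-*ₚ : ∀ p q t → eval (p *ₚ q) t ≈ℂ eval p t *ℂ eval q t
eval-*ₚ []      q t = ℂₛ.sym (ℂₛ.zeroˡ (eval q t))
eval-*ₚ (a ∷ p) q t = begin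
  eval (a ·ₚ q +ₚ (0ℚ ∷ p *ₚ q)) t
    ≈⟨ eval-+ₚ (a ·ₚ q) _ t ⟩
  eval (a ·ₚ q) t +ℂ (0ℂ +ℂ t *ℂ eval (p *ₚ q) t)
    ≈⟨ ℂₛ.+-cong (eval-·ₚ a q t) (ℂₛ.trans (ℂₛ.+-identityˡ _) (ℂₛ.*-congˡ (eval-*ₚ p q t))) ⟩
  ofℚ a *ℂ eval q t +ℂ t *ℂ (eval p t *ℂ eval q t)
    ≈⟨ ℂ-solve 4 (λ a t P Q → a ⊗ Q ⊕ t ⊗ (P ⊗ Q) ⊜ (a ⊕ t ⊗ P) ⊗ Q) ℂₛ.refl
         (ofℚ a) t (eval p t) (eval q t) ⟩
  (ofℚ a +ℂ t *ℂ eval p t) *ℂ eval q t ∎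

-- Cosines of multiples of an angle.

-- Equality at every index spares a continuity argument for `cos`; the angles compared below do
-- agree exactly.
cos-cong-≗ : ∀ {x y} → seq x ≗ seq y → cos x ≈ℝ cos y
cos-cong-≗ {x} {y} x≡y = pointwise λ n → trans (seq-cosSum n x n)
  (trans (cong (cosSumℚ n) (x≡y n)) (sym (seq-cosSum n y n)))

cosMultiple : ℝ → ℕ → ℝ
cosMultiple θ k = cos (fromℚ (fromℕ k) *ℝ θ)

cosMultiple-0 : ∀ θ → cosMultiple θ 0 ≈ℝ 1ℝ
cosMultiple-0 θ = ≈ℝ-trans
  (cos-cong-≗ {fromℚ 0ℚ *ℝ θ} {0ℝ} (λ n → *-zeroˡ (seq θ n)))
  -- The empty partial sum is 0, so the value 1 is attained only from index 1 on.
  (mk≈ λ ε 0<ε → 1 , λ { (suc n) _ →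
    subst (λ q → ∣ q - 1ℚ ∣ < ε)
      (sym (trans (seq-cosSum (suc n) 0ℝ (suc n)) (cosSumℚ-0 n))) (dist-refl 1ℚ 0<ε) })
  where
  cosSumℚ-0 : ∀ n → cosSumℚ (suc n) 0ℚ ≡ 1ℚ
  cosSumℚ-0 zero    = refl
  cosSumℚ-0 (suc n) = trans
    (cong₂ (λ p q → p + cosCoeff (suc n) * q) (cosSumℚ-0 n)
      (trans (cong (0ℚ ^ℚ_) (2·suc n)) (*-zeroˡ (0ℚ * 0ℚ ^ℚ (2 ℕ.* n)))))
    (trans (cong (λ q → 1ℚ + q) (*-zeroʳ (cosCoeff (suc n)))) (+-identityʳ 1ℚ))

cosMultiple-1 : ∀ θ → cosMultiple θ 1 ≈ℝ cos θ
cosMultiple-1 θ = cos-cong-≗ λ n → *-identityˡ (seq θ n)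

-- `cos-product` at `(k+1)θ` and `θ`, whose sum and difference are `(k+2)θ` and `kθ`.
chebyshev : ∀ θ k → cosMultiple θ (suc (suc k)) +ℝ cosMultiple θ k
  ≈ℝ fromℚ 2ℚ *ℝ (cosMultiple θ (suc k) *ℝ cos θ)
chebyshev θ k = ≈ℝ-trans
  (+ℝ-cong
    (cos-cong-≗ λ n → trans (cong (_* seq θ n) (fromℕ-suc (suc k)))
      (solve 2 (λ m t → (con 1ℚ :+ m) :* t := m :* t :+ t) refl (fromℕ (suc k)) (seq θ n)))
    (cos-cong-≗ λ n → sym (trans (cong (λ q → q * seq θ n + - seq θ n) (fromℕ-suc k))
      (solve 2 (λ m t → (con 1ℚ :+ m) :* t :+ :- t := m :* t) refl (fromℕ k) (seq θ n)))))
  (cos-product (fromℚ (fromℕ (suc k)) *ℝ θ) θ)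

-- With `cos θ = 0` the recurrence reads `cos((k+2)θ) = -cos(kθ)`, so zeros propagate in steps of
-- two.
cosMultiple-odd : ∀ θ → cos θ ≈ℝ 0ℝ → ∀ j → cosMultiple θ (2 ℕ.* j ℕ.+ 1) ≈ℝ 0ℝ
cosMultiple-odd θ cosθ≈0 zero    = ≈ℝ-trans (cosMultiple-1 θ) cosθ≈0
cosMultiple-odd θ cosθ≈0 (suc j) =
  subst (λ k → cosMultiple θ (k ℕ.+ 1) ≈ℝ 0ℝ) (sym (2·suc j))
    -- A zero is added and then replaced by `cos(kθ)`, zero by induction, to match the left side of
    -- `chebyshev`.
    (≈ℝ-trans (pointwise λ n → sym (+-identityʳ _))
      (≈ℝ-trans (+ℝ-cong ≈ℝ-refl (≈ℝ-sym (cosMultiple-odd θ cosθ≈0 j)))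
        (≈ℝ-trans (chebyshev θ k)
          (≈ℝ-trans (*ℝ-cong ≈ℝ-refl (*ℝ-cong ≈ℝ-refl cosθ≈0))
            (pointwise λ n → solve 1 (λ c → con 2ℚ :* (c :* con 0ℚ) := con 0ℚ) refl
              (seq (cosMultiple θ (suc k)) n))))))
  where k = 2 ℕ.* j ℕ.+ 1

chebyshevℂ : ∀ θ k → ofℝ (cosMultiple θ (suc (suc k))) +ℂ ofℝ (cosMultiple θ k)
  ≈ℂ ofℚ 2ℚ *ℂ (ofℝ (cosMultiple θ (suc k)) *ℂ ofℝ (cos θ))
chebyshevℂ θ k = begin
  ofℝ (cosMultiple θ (suc (suc k))) +ℂ ofℝ (cosMultiple θ k)
    ≈⟨ ofℝ-+ _ _ ⟨
  ofℝ (cosMultiple θ (suc (suc k)) +ℝ cosMultiple θ k)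
    ≈⟨ ofℝ-cong (chebyshev θ k) ⟩
  ofℝ (fromℚ 2ℚ *ℝ (cosMultiple θ (suc k) *ℝ cos θ))
    ≈⟨ ℂₛ.trans (ofℝ-* _ _) (ℂₛ.*-congˡ (ofℝ-* _ _)) ⟩
  ofℚ 2ℚ *ℂ (ofℝ (cosMultiple θ (suc k)) *ℂ ofℝ (cos θ)) ∎

-- Closed form of the Lucas-type polynomials at `t`.

infixr 8 _^ℂ_

_^ℂ_ : ℂ → ℕ → ℂ
z ^ℂ zero  = 1ℂ
z ^ℂ suc n = z *ℂ z ^ℂ n

module _ (F : LucasType) where
  open LucasType F

  p₀*α : p₀ * α ≡ 2ℚ
  p₀*α = trans
    (solve 2 (λ p q → p :* (con 2ℚ :* q) := con 2ℚ :* (p :* q)) refl p₀ (1/ p₀))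
    (cong (2ℚ *_) (*-inverseʳ p₀))
    where instance _ = initialValue-nonZero p₀∈[±1,±2]

  -- Since `p₀ α = 2` and `d = α p₁`, the initial polynomial is `p₀ d / 2`; inserting the factor
  -- `½ * (p₀ * α)`, equal to 1, avoids a division by `α`.
  eval-p₁ : ∀ t → eval p₁ t ≈ℂ ofℚ ½ *ℂ (ofℚ p₀ *ℂ eval d t)
  eval-p₁ t = begin
    eval p₁ t
      ≈⟨ ℂₛ.*-identityˡ _ ⟨
    1ℂ *ℂ eval p₁ t
      ≈⟨ ℂₛ.*-congʳ (ofℚ-cong (cong (½ *_) (sym p₀*α))) ⟩
    ofℚ (½ * (p₀ * α)) *ℂ eval p₁ t
      ≈⟨ ℂₛ.*-congʳ (ℂₛ.trans (ofℚ-* ½ (p₀ * α)) (ℂₛ.*-congˡ (ofℚ-* p₀ α))) ⟩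
    ofℚ ½ *ℂ (ofℚ p₀ *ℂ ofℚ α) *ℂ eval p₁ t
      ≈⟨ ℂ-solve 4 (λ h p a e → h ⊗ (p ⊗ a) ⊗ e ⊜ h ⊗ (p ⊗ (a ⊗ e))) ℂₛ.refl
           (ofℚ ½) (ofℚ p₀) (ofℚ α) (eval p₁ t) ⟩
    ofℚ ½ *ℂ (ofℚ p₀ *ℂ (ofℚ α *ℂ eval p₁ t))
      ≈⟨ ℂₛ.*-congˡ (ℂₛ.*-congˡ (ℂₛ.trans (eval-cong d (α ·ₚ p₁) t d≈αp₁) (eval-·ₚ α p₁ t))) ⟨
    ofℚ ½ *ℂ (ofℚ p₀ *ℂ eval d t) ∎

  module _ (t w : ℂ) (θ : ℝ) (g≈-w² : eval g t +ℂ w *ℂ w ≈ℂ 0ℂ)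
    (d≈2wcosθ : eval d t ≈ℂ ofℚ 2ℚ *ℂ (w *ℂ ofℝ (cos θ))) where

    -- The Binet form `p₀ (a^m + b^m) / 2` for `a, b = w e^(±iθ)`, where `a + b = d(t)` and
    -- `a b = -g(t)`, written without complex exponentials.
    lucas-value : ℕ → ℂ
    lucas-value m = ofℚ p₀ *ℂ w ^ℂ m *ℂ ofℝ (cosMultiple θ m)

    eval-𝓛 : ∀ m → eval (𝓛 m) t ≈ℂ lucas-value m
    eval-𝓛 zero = begin
      ofℚ p₀ +ℂ t *ℂ 0ℂ ≈⟨ ℂₛ.+-congˡ (ℂₛ.zeroʳ t) ⟩
      ofℚ p₀ +ℂ 0ℂ      ≈⟨ ℂₛ.+-identityʳ _ ⟩
      ofℚ p₀            ≈⟨ ℂₛ.trans (ℂₛ.*-identityʳ _) (ℂₛ.*-identityʳ _) ⟨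
      ofℚ p₀ *ℂ 1ℂ *ℂ 1ℂ ≈⟨ ℂₛ.*-congˡ (ofℝ-cong (cosMultiple-0 θ)) ⟨
      lucas-value 0 ∎
    eval-𝓛 (suc zero) = begin
      eval p₁ t
        ≈⟨ eval-p₁ t ⟩
      ofℚ ½ *ℂ (ofℚ p₀ *ℂ eval d t)
        ≈⟨ ℂₛ.*-congˡ (ℂₛ.*-congˡ d≈2wcosθ) ⟩
      ofℚ ½ *ℂ (ofℚ p₀ *ℂ (ofℚ 2ℚ *ℂ (w *ℂ c)))
        ≈⟨ ℂ-solve 5 (λ h p k w c → h ⊗ (p ⊗ (k ⊗ (w ⊗ c))) ⊜ h ⊗ k ⊗ (p ⊗ w ⊗ c)) ℂₛ.refl
             (ofℚ ½) (ofℚ p₀) (ofℚ 2ℚ) w c ⟩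
      ofℚ ½ *ℂ ofℚ 2ℚ *ℂ (ofℚ p₀ *ℂ w *ℂ c)
        ≈⟨ ℂₛ.trans (ℂₛ.*-congʳ (ℂₛ.sym (ofℚ-* ½ 2ℚ))) (ℂₛ.*-identityˡ _) ⟩
      ofℚ p₀ *ℂ w *ℂ c
        ≈⟨ ℂₛ.*-cong (ℂₛ.*-congˡ (ℂₛ.*-identityʳ w)) (ofℝ-cong (cosMultiple-1 θ)) ⟨
      lucas-value 1 ∎
      where c = ofℝ (cos θ)
    eval-𝓛 (suc (suc m)) = begin
      eval (d *ₚ 𝓛 (suc m) +ₚ g *ₚ 𝓛 m) t
        ≈⟨ ℂₛ.trans (eval-+ₚ (d *ₚ 𝓛 (suc m)) (g *ₚ 𝓛 m) t)
             (ℂₛ.+-cong (eval-*ₚ d (𝓛 (suc m)) t) (eval-*ₚ g (𝓛 m) t)) ⟩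
      eval d t *ℂ eval (𝓛 (suc m)) t +ℂ G *ℂ eval (𝓛 m) t
        ≈⟨ ℂₛ.+-cong (ℂₛ.*-cong d≈2wcosθ (eval-𝓛 (suc m))) (ℂₛ.*-congˡ (eval-𝓛 m)) ⟩
      ofℚ 2ℚ *ℂ (w *ℂ c) *ℂ (ofℚ p₀ *ℂ (w *ℂ v) *ℂ C₁) +ℂ G *ℂ (ofℚ p₀ *ℂ v *ℂ C₀)
        ≈⟨ ℂ-solve 8 (λ k w c p v C₁ G C₀ →
               k ⊗ (w ⊗ c) ⊗ (p ⊗ (w ⊗ v) ⊗ C₁) ⊕ G ⊗ (p ⊗ v ⊗ C₀)
               ⊜ p ⊗ (w ⊗ (w ⊗ v)) ⊗ (k ⊗ (C₁ ⊗ c)) ⊕ G ⊗ (p ⊗ v ⊗ C₀)) ℂₛ.refl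
             (ofℚ 2ℚ) w c (ofℚ p₀) v C₁ G C₀ ⟩
      ofℚ p₀ *ℂ (w *ℂ (w *ℂ v)) *ℂ (ofℚ 2ℚ *ℂ (C₁ *ℂ c)) +ℂ G *ℂ (ofℚ p₀ *ℂ v *ℂ C₀)
        ≈⟨ ℂₛ.+-congʳ (ℂₛ.*-congˡ (chebyshevℂ θ m)) ⟨
      ofℚ p₀ *ℂ (w *ℂ (w *ℂ v)) *ℂ (C₂ +ℂ C₀) +ℂ G *ℂ (ofℚ p₀ *ℂ v *ℂ C₀)
        -- The unwanted `C₀` of the Chebyshev recurrence comes with `w²` and joins the `g` term;
        -- their common factor `G + w²` vanishes.
        ≈⟨ ℂ-solve 6 (λ w p v C₂ G C₀ →
               p ⊗ (w ⊗ (w ⊗ v)) ⊗ (C₂ ⊕ C₀) ⊕ G ⊗ (p ⊗ v ⊗ C₀)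
               ⊜ p ⊗ (w ⊗ (w ⊗ v)) ⊗ C₂ ⊕ (G ⊕ w ⊗ w) ⊗ (p ⊗ v ⊗ C₀)) ℂₛ.refl
             w (ofℚ p₀) v C₂ G C₀ ⟩
      lucas-value (suc (suc m)) +ℂ (G +ℂ w *ℂ w) *ℂ lucas-value m
        ≈⟨ ℂₛ.+-congˡ (ℂₛ.trans (ℂₛ.*-congʳ g≈-w²) (ℂₛ.zeroˡ _)) ⟩
      lucas-value (suc (suc m)) +ℂ 0ℂ
        ≈⟨ ℂₛ.+-identityʳ _ ⟩
      lucas-value (suc (suc m)) ∎
      where
      c  = ofℝ (cos θ)
      v  = w ^ℂ m
      G  = eval g t
      C₀ = ofℝ (cosMultiple θ m)
      C₁ = ofℝ (cosMultiple θ (suc m))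
      C₂ = ofℝ (cosMultiple θ (suc (suc m)))

-- The angle `θ` and the vanishing of `cos(nθ)`.

/-*-cancel : ∀ m k .{{_ : NonZero k}} → (ℤ.+ m / k) * fromℕ k ≡ fromℕ m
/-*-cancel m k@(suc _) = toℚᵘ-injective
  (ℚᵘ.≃-trans (toℚᵘ-homo-* (ℤ.+ m / k) (fromℕ k))
    (ℚᵘ.≃-trans (ℚᵘ.*-cong (toℚᵘ-/ (ℤ.+ m) k) (toℚᵘ-/ (ℤ.+ k) 1))
      (ℚᵘ.≃-trans (ℚᵘ.*≡* cross) (ℚᵘ.≃-sym (toℚᵘ-/ (ℤ.+ m) 1)))))
  where
  cross : ℤ.+ m ℤ.* ℤ.+ k ℤ.* ℤ.+ 1 ≡ ℤ.+ m ℤ.* ℤ.+ (k ℕ.* 1)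
  cross = trans (ℤ.*-assoc (ℤ.+ m) (ℤ.+ k) (ℤ.+ 1)) (cong (ℤ.+ m ℤ.*_) (sym (ℤ.pos-* k 1)))

-- Turns `nθ` into the multiple `m` of `π/2`, with `m = 2j+1` in the application.
half-fraction : ∀ m n .{{_ : NonZero n}} .{{_ : NonZero (2 ℕ.* n)}} →
  fromℕ n * (ℤ.+ m / (2 ℕ.* n)) ≡ fromℕ m * ½
half-fraction m n = trans
  (solve 2 (λ n r → n :* r := r :* (con 2ℚ :* n) :* con ½) refl (fromℕ n) r)
  (cong (_* ½) (trans (cong (r *_) (sym (fromℕ-* 2 n))) (/-*-cancel m (2 ℕ.* n))))
  where r = ℤ.+ m / (2 ℕ.* n)

theorem4p4 : ∀ (π : ℝ) → IsPi π →
    ∀ (n : ℕ) .{{_ : NonZero n}} (F : LucasType) →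
    let open LucasType F in
    ∀ (t : ℂ) (g[t]≠0 : eval g t ≠0) (√g[t] : SquareRoot (eval g t)) →
    (∃[ j ] (eval d t /ℂ root √g[t] ⟨ root-≠0 g[t]≠0 √g[t] ⟩) ≈ℂ τ π n j) →
    IsRoot t (𝓛 n)
theorem4p4 π isPi n F t g[t]≠0 √g[t] (j , quotient≈τ) = begin
  eval (𝓛 n) t
    ≈⟨ eval-𝓛 F t w θ g≈-w² d≈2wcosθ n ⟩
  ofℚ p₀ *ℂ w ^ℂ n *ℂ ofℝ (cosMultiple θ n)
    ≈⟨ ℂₛ.*-congˡ (ofℝ-cong (≈ℝ-trans
         (cos-cong-≗ {fromℚ (fromℕ n) *ℝ θ} {fromℚ (fromℕ m) *ℝ (fromℚ ½ *ℝ π)} same-angle)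
         (cosMultiple-odd (fromℚ ½ *ℝ π) (IsPi.zero-π/2 isPi) (toℕ j)))) ⟩
  ofℚ p₀ *ℂ w ^ℂ n *ℂ 0ℂ
    ≈⟨ ℂₛ.zeroʳ _ ⟩
  0ℂ ∎
  where
  open LucasType F
  instance _ = ℕ.m*n≢0 2 n
  m = 2 ℕ.* toℕ j ℕ.+ 1
  -- The same expression as inside `τ`, so that `quotient≈τ` applies directly.
  θ = fromℚ (ℤ.+ m / (2 ℕ.* n)) *ℝ π
  s = root √g[t]
  s≠0 = root-≠0 g[t]≠0 √g[t]
  -- The factor `i` of `τ` is absorbed into `w`: then `d(t) = τ s` becomes `2 w cos θ`, and `w²`
  -- becomes `-g(t)`.
  w = 𝕚 *ℂ s
  g≈-w² : eval g t +ℂ w *ℂ w ≈ℂ 0ℂ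
  g≈-w² = ℂₛ.trans (ℂₛ.+-congʳ (ℂₛ.sym (sq-≈z √g[t]))) (𝕚-square s)
  d≈2wcosθ : eval d t ≈ℂ ofℚ 2ℚ *ℂ (w *ℂ ofℝ (cos θ))
  d≈2wcosθ = begin
    eval d t                                ≈⟨ /ℂ-*ℂ (eval d t) s s≠0 ⟨
    (eval d t /ℂ s ⟨ s≠0 ⟩) *ℂ s            ≈⟨ ℂₛ.*-congʳ quotient≈τ ⟩
    ofℚ 2ℚ *ℂ 𝕚 *ℂ ofℝ (cos θ) *ℂ s
      ≈⟨ ℂ-solve 4 (λ k i c s → k ⊗ i ⊗ c ⊗ s ⊜ k ⊗ (i ⊗ s ⊗ c)) ℂₛ.refl
           (ofℚ 2ℚ) 𝕚 (ofℝ (cos θ)) s ⟩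
    ofℚ 2ℚ *ℂ (w *ℂ ofℝ (cos θ))           ∎
  same-angle : ∀ k → fromℕ n * ((ℤ.+ m / (2 ℕ.* n)) * seq π k) ≡ fromℕ m * (½ * seq π k)
  same-angle k = trans (sym (*-assoc (fromℕ n) _ _))
    (trans (cong (_* seq π k) (half-fraction m n)) (*-assoc (fromℕ m) ½ _))
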